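{- Let $\mathcal{A}$ be a minimally self-adjusting BST algorithm and suppose there are constants $\epsilon>0$, $c>0$, $D>0$ such that for every access performed by $\mathcal{A}$: (i) every node $x$ on the search path loses at least $(\frac12+\epsilon)\,d(x)-c$ ancestors, and (ii) every node on the search path other than the accessed element gains at most $D$ new descendants. Then $\mathcal{A}$ satisfies the access lemma.
   Context: Keys $[n]$; for a BST $T$ and node $a$, $T(a)$ is the set of keys in the subtree rooted at $a$. Weights $w:[n]\to\mathbb{R}_{>0}$, $w(S)=\sum_{a\in S}w(a)$, $W=w([n])$; $\Phi_T=\sum_{a\in[n]}\log_2 w(T(a))$. A minimally self-adjusting BST algorithm, on access to $s$ in $T$ with search path $P$ (nodes on the root-to-$s$ path including $s$), replaces $P$ by a BST $A$ on node set $P$ with root $s$ (the after-tree), reattaching the subtrees hanging off $P$ in the unique order-consistent way, producing $T'$; cost $|P|$. It satisfies the access lemma if there is a constant $c'$ such that always $|P|\le\Phi_T-\Phi_{T'}+c'(1+\log_2\frac{W}{w(s)})$ (for all $n,T,w,s$ and all $T'$ the algorithm can produce). For nodes $x,y\in P$: if $y$ is an ancestor of $x$ in the search path but not in the after-tree $A$, then $x$ loses the ancestor $y$ and $y$ loses the descendant $x$; if $y$ is an ancestor of $x$ in $A$ but not in the search path, $x$ gains the ancestor $y$ and $y$ gains the descendant $x$. Only nodes of $P$ count as ancestors/descendants here (not nodes of the pendent subtrees). $d(x)$ denotes the number of ancestors of $x$ in the search path.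
   Formalization: The weights w in the access lemma are positive rationals instead of positive reals (and ε is rational, c, D, c' natural numbers); the lemma's inequality is stated in the equivalent exponentiated form without logarithms. -}

module Defs where

open import Data.Nat as ℕ using (ℕ; zero; suc; _<_; _≡ᵇ_)
open import Data.Integer using (+_)
open import Data.Bool using (Bool; true; false; if_then_else_; not; _∧_)
open import Data.List using (List; []; _∷_; _++_; [_]; length; upTo; foldr)
open import Data.Bool.ListAction using (any)
open import Data.List.Membership.Propositional using (_∈_)
open import Data.List.Relation.Unary.Linked using (Linked)
open import Data.List.Relation.Binary.Permutation.Propositional using (_↭_)
open import Data.Product using (_×_; _,_; proj₁)
open import Data.Rational as ℚ using (ℚ; 0ℚ; 1ℚ)
open import Relation.Binary.PropositionalEquality using (_≡_)

data Tree : Set where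
  leaf : Tree
  node : Tree → ℕ → Tree → Tree

inorder : Tree → List ℕ
inorder leaf = []
inorder (node l k r) = inorder l ++ (k ∷ inorder r)

IsBST : ℕ → Tree → Set
IsBST n T = inorder T ≡ upTo n

root : Tree → List ℕ
root leaf = []
root (node _ k _) = [ k ]

searchPath : Tree → ℕ → List ℕ
searchPath leaf s = []
searchPath (node l k r) s with s ℕ.<ᵇ k | k ℕ.<ᵇ s
... | true  | _     = k ∷ searchPath l s
... | false | true  = k ∷ searchPath r s
... | false | false = [ k ]

pendants : Tree → ℕ → List Tree
pendants leaf s = [ leaf ]
pendants (node l k r) s with s ℕ.<ᵇ k | k ℕ.<ᵇ s
... | true  | _     = pendants l s ++ [ r ]
... | false | true  = l ∷ pendants r s
... | false | false = l ∷ r ∷ []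

fill : Tree → List Tree → Tree × List Tree
fill leaf []       = leaf , []
fill leaf (t ∷ ts) = t , ts
fill (node l k r) ts with fill l ts
... | l' , ts₁ with fill r ts₁
... | r' , ts₂ = node l' k r' , ts₂

IsAfterTree : Tree → ℕ → Tree → Set
IsAfterTree T s A = (inorder A ↭ searchPath T s) × Linked _<_ (inorder A) × root A ≡ [ s ]

-- The tree T' obtained by replacing the search path with A and reattaching
-- the pendant subtrees in the unique order-consistent way.
restructure : Tree → ℕ → Tree → Tree
restructure T s A = proj₁ (fill A (pendants T s))

-- A minimally self-adjusting BST algorithm, described by the after-trees it can
-- produce: step n T s A means that, when accessing s in the BST T on [n], the
-- algorithm can choose the after-tree A.
record MinSelfAdjAlg : Set₁ where
  field
    step      : ℕ → Tree → ℕ → Tree → Set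
    afterTree : ∀ {n T s A} → IsBST n T → s < n → step n T s A → IsAfterTree T s A

open MinSelfAdjAlg public

Access : MinSelfAdjAlg → ℕ → Tree → ℕ → Tree → Set
Access 𝒜 n T s A = IsBST n T × s < n × step 𝒜 n T s A

_∈ᵇ_ : ℕ → List ℕ → Bool
x ∈ᵇ xs = any (λ y → y ≡ᵇ x) xs

count : (ℕ → Bool) → List ℕ → ℕ
count p [] = 0
count p (x ∷ xs) = if p x then suc (count p xs) else count p xs

ancestors : Tree → ℕ → List ℕ
ancestors leaf x = []
ancestors (node l k r) x =
  if x ∈ᵇ inorder l then k ∷ ancestors l x
  else if x ∈ᵇ inorder r then k ∷ ancestors r x
  else []

depth : Tree → ℕ → ℕ
depth T x = length (ancestors T x)

-- Number of ancestors x loses: ancestors of x in T (all on the search path)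
-- that are not ancestors of x in the after-tree A.
lostAncestors : Tree → Tree → ℕ → ℕ
lostAncestors T A x = count (λ y → not (y ∈ᵇ ancestors A x)) (ancestors T x)

gainedDescendants : Tree → ℕ → Tree → ℕ → ℕ
gainedDescendants T s A y =
  count (λ x → (y ∈ᵇ ancestors A x) ∧ not (y ∈ᵇ ancestors T x)) (searchPath T s)

ℕtoℚ : ℕ → ℚ
ℕtoℚ n = + n ℚ./ 1

weightOf : (ℕ → ℚ) → List ℕ → ℚ
weightOf w xs = foldr (λ a acc → w a ℚ.+ acc) 0ℚ xs

-- 2^{Φ_T} = ∏_{a} w(T(a))
expPotential : (ℕ → ℚ) → Tree → ℚ
expPotential w leaf = 1ℚ
expPotential w (node l k r) =
  weightOf w (inorder (node l k r)) ℚ.* (expPotential w l ℚ.* expPotential w r)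

_^ℚ_ : ℚ → ℕ → ℚ
q ^ℚ zero = 1ℚ
q ^ℚ suc m = q ℚ.* (q ^ℚ m)

PosWeights : ℕ → (ℕ → ℚ) → Set
PosWeights n w = ∀ a → a < n → 0ℚ ℚ.< w a

-- Access lemma, in exponentiated form with an integral constant c':
--   |P| ≤ Φ_T − Φ_T' + c'(1 + log₂(W / w(s)))
-- ⇔ 2^|P| · w(s)^{c'} · 2^{Φ_T'} ≤ 2^{c'} · W^{c'} · 2^{Φ_T}.
AccessLemma : MinSelfAdjAlg → Set
AccessLemma 𝒜 = Data.Product.Σ ℕ λ c' →
  ∀ n T s A (w : ℕ → ℚ) → PosWeights n w → Access 𝒜 n T s A →
  let W = weightOf w (upTo n)
      P = searchPath T s
      T' = restructure T s A
  in (ℕtoℚ 2 ^ℚ length P) ℚ.* ((w s ^ℚ c') ℚ.* expPotential w T')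
       ℚ.≤ (ℕtoℚ 2 ^ℚ c') ℚ.* ((W ^ℚ c') ℚ.* expPotential w T)

{-# OPTIONS --safe #-}
-- Fix one side of s and let x₀, x₁, … be the path nodes on that side, top-down.
-- If xⱼ is a descendant of xᵢ in the after-tree for some j < i, then xᵢ gains
-- xⱼ, …, xᵢ₋₁; so by (ii) T′(xᵢ) ⊆ T(xᵢ₋D), and potential can increase on the
-- side by at most D log (W / w(s)).  If moreover xᵢ loses some descendant xₖ on
-- its side, the lowest common ancestor of xᵢ and xₖ in the after-tree gains xᵢ, so
-- it is one of the next D nodes and cuts T′(xᵢ) off from T(xᵢ₊D₊₁): hence
-- w(T′(xᵢ)) ≤ w(T(xᵢ₋D)) − w(T(xᵢ₊D₊₁)).  As 2^K (β − γ) ≤ β (β/γ)^(2^K) and the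
-- quotients telescope, every such loser drops the potential by any prescribed
-- constant K, up to an error O(log (W / w(s))).  Finally, (i) for the last node on
-- the side with more path nodes yields at least ε |P| / 2 − O(1) losers there, because
-- ancestors on the other side account for at most about half of the depth; choose
-- K of order 1/ε.
module Submission where

open import Defs
open import Data.Nat as ℕ using (ℕ; zero; suc; z≤n; s≤s)
open import Data.Bool using (Bool; true; false; T; not; _∧_; if_then_else_)
open import Data.Bool.Properties using (T-≡)
open import Data.List using (List; []; _∷_; _++_; [_]; length; filterᵇ; upTo; applyUpTo; drop)
open import Data.List.Properties using (++-identityʳ; ++-assoc; filter-++; length-++; drop-drop)
open import Data.List.Membership.Propositional using (_∈_; _∉_)
open import Data.List.Membership.Propositional.Properties using (∈-++⁺ˡ; ∈-++⁺ʳ; ∈-++⁻; ∈-∃++; ∈-insert; ∈-upTo⁺)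
open import Data.List.Relation.Unary.Any as Any using (here; there)
open import Data.List.Relation.Unary.Any.Properties using (any⁺; any⁻)
open import Data.List.Relation.Unary.All as All using (All; []; _∷_)
import Data.List.Relation.Unary.All.Properties as All
open import Data.List.Relation.Unary.AllPairs as AllPairs using (AllPairs; []; _∷_)
import Data.List.Relation.Unary.AllPairs.Properties as AllPairs
open import Data.List.Relation.Unary.Linked as Linked using (Linked)
open import Data.List.Relation.Unary.Linked.Properties using (AllPairs⇒Linked)
open import Data.List.Relation.Unary.Sorted.TotalOrder.Properties using (↗↭↗⇒≋)
open import Data.List.Relation.Binary.Pointwise using (Pointwise-≡⇒≡)
open import Data.List.Relation.Binary.Permutation.Propositional
  using (_↭_; ↭⇒↭ₛ; ↭-refl; ↭-sym; ↭-trans; prep)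
open import Data.List.Relation.Binary.Permutation.Propositional.Properties using (++-comm; ∈-resp-↭)
open import Data.Product using (∃; ∃₂; _×_; _,_; proj₁; proj₂)
open import Data.Sum as Sum using (_⊎_; inj₁; inj₂)
open import Function using (_∘_; case_of_)
open import Function.Bundles using (Equivalence)
open import Relation.Binary.Definitions using (Tri; tri<; tri≈; tri>)
open import Relation.Binary.PropositionalEquality as ≡ using (_≡_; _≢_; sym; cong; cong₂; subst)
open import Relation.Nullary using (¬_; yes; no; contradiction)

-- Every key set `T(x)` is an interval of keys, so containment and disjointness become comparisons
-- of endpoints, and weights become differences of prefix sums. `T` and `T′` are two trees on the
-- same path nodes, filled with the same pendent subtrees; the factors of these agree on both sides,
-- which leaves the intervals of the path nodes. Potentials stay products and quotients such as β/γ
-- are cleared, so no logarithm occurs.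
--
-- A single loser need not lower the potential: its new weight can be close to β when γ is tiny. But
-- then β/γ is large, and the price (β/γ)^(2^K) is affordable: the nodes of β and γ are 2D+1
-- positions apart on one path, so all prices together multiply to at most W / w(s) to the power
-- (2D+1) 2^K.
--
-- The threshold 1/2 in (i) comes from `s` being the root of the after-tree: it separates the sides,
-- so ancestors on the other side are lost without any effect on this side. Only the surplus ε
-- produces losers.
--
-- The sides are mirror images; the order `_<[ σ ]_`, reversed for keys above `s`, lets one argument
-- serve both.

module SearchPaths where
  open import Data.Nat using (_+_; _*_; _≤_; _<_; _<ᵇ_; _≡ᵇ_)
  open import Data.Nat.Properties
  open import Data.Nat.Solver using (module +-*-Solver)
  open ≡ using (refl; sym; trans; cong; cong₂; subst; module ≡-Reasoning)

  private variable
    lo hi k s x y z p q a b c d : ℕ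
    l r A X : Tree
    P xs ys : List ℕ
    ts us : List Tree
    σ : Bool

  -- Ancestor lists and key intervals of search trees

  T⇒≡ : ∀ {v} → T v → v ≡ true
  T⇒≡ = Equivalence.to T-≡

  ≡⇒T : ∀ {v} → v ≡ true → T v
  ≡⇒T = Equivalence.from T-≡

  ∈⇒∈ᵇ : x ∈ xs → (x ∈ᵇ xs) ≡ true
  ∈⇒∈ᵇ {x} x∈xs = T⇒≡ (any⁺ _ (Any.map (λ { {y} refl → ≡⇒≡ᵇ y y refl }) x∈xs))

  ∈ᵇ⇒∈ : (x ∈ᵇ xs) ≡ true → x ∈ xs
  ∈ᵇ⇒∈ {x} {xs} e = Any.map (λ {y} t → sym (≡ᵇ⇒≡ y x t)) (any⁻ _ xs (≡⇒T e))

  ∉⇒∈ᵇ : x ∉ xs → (x ∈ᵇ xs) ≡ false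
  ∉⇒∈ᵇ {x} {xs} x∉xs with x ∈ᵇ xs in e
  ... | true  = contradiction (∈ᵇ⇒∈ {x} {xs} e) x∉xs
  ... | false = refl

  ancestors-left : ∀ l k r → x ∈ inorder l → ancestors (node l k r) x ≡ k ∷ ancestors l x
  ancestors-left l k r x∈l rewrite ∈⇒∈ᵇ x∈l = refl

  ancestors-right : ∀ l k r → x ∉ inorder l → x ∈ inorder r → ancestors (node l k r) x ≡ k ∷ ancestors r x
  ancestors-right l k r x∉l x∈r rewrite ∉⇒∈ᵇ x∉l | ∈⇒∈ᵇ x∈r = refl

  ancestors-root : ∀ l k r → x ∉ inorder l → x ∉ inorder r → ancestors (node l k r) x ≡ []
  ancestors-root l k r x∉l x∉r rewrite ∉⇒∈ᵇ x∉l | ∉⇒∈ᵇ x∉r = refl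

  -- Only bounds are recorded, so keys may be skipped. The predicate thus covers full trees as well
  -- as trees on the path nodes alone, where the range from `lo` to `hi` also holds the keys of the
  -- pendent subtrees.
  data Within : ℕ → ℕ → Tree → Set where
    leaf : Within lo hi leaf
    node : lo ≤ k → k < hi → Within lo k l → Within (suc k) hi r → Within lo hi (node l k r)

  Within-∈ : Within lo hi X → x ∈ inorder X → lo ≤ x × x < hi
  Within-∈ (node {l = l} lo≤k k<hi wl wr) x∈ with ∈-++⁻ (inorder l) x∈
  ... | inj₁ x∈l with lo≤x , x<k ← Within-∈ wl x∈l = lo≤x , <-trans x<k k<hi
  ... | inj₂ (here refl) = lo≤k , k<hi
  ... | inj₂ (there x∈r) with k<x , x<hi ← Within-∈ wr x∈r = ≤-trans lo≤k (<⇒≤ k<x) , x<hi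

  -- The keys of the subtree of y are those in [a, b) when the keys of the whole
  -- tree, pendent subtrees included, are those in [lo, hi).
  data Spans : Tree → ℕ → ℕ → ℕ → ℕ → ℕ → Set where
    here  : Spans (node l k r) lo hi k lo hi
    left  : Spans l lo k y a b → Spans (node l k r) lo hi y a b
    right : Spans r (suc k) hi y a b → Spans (node l k r) lo hi y a b

  Spans-∈ : Spans X lo hi y a b → y ∈ inorder X
  Spans-∈ {node l k r} here      = ∈-insert (inorder l)
  Spans-∈ {node l k r} (left S)  = ∈-++⁺ˡ (Spans-∈ S)
  Spans-∈ {node l k r} (right S) = ∈-++⁺ʳ (inorder l) (there (Spans-∈ S))

  Spans-bounds : Within lo hi X → Spans X lo hi y a b → lo ≤ a × b ≤ hi
  Spans-bounds (node lo≤k k<hi wl wr) here = ≤-refl , ≤-refl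
  Spans-bounds (node lo≤k k<hi wl wr) (left S) with lo≤a , b≤k ← Spans-bounds wl S =
    lo≤a , ≤-trans b≤k (<⇒≤ k<hi)
  Spans-bounds (node lo≤k k<hi wl wr) (right S) with k<a , b≤hi ← Spans-bounds wr S =
    ≤-trans lo≤k (<⇒≤ k<a) , b≤hi

  Spans-self : Within lo hi X → Spans X lo hi y a b → a ≤ y × y < b
  Spans-self (node lo≤k k<hi wl wr) here      = lo≤k , k<hi
  Spans-self (node lo≤k k<hi wl wr) (left S)  = Spans-self wl S
  Spans-self (node lo≤k k<hi wl wr) (right S) = Spans-self wr S

  -- A total function beside the relation `Spans`, because the potential is written as a product
  -- over keys whose factors are the weights of these intervals.
  span : Tree → ℕ → ℕ → ℕ → ℕ × ℕ
  span leaf         lo hi y = lo , hi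
  span (node l k r) lo hi y with <-cmp y k
  ... | tri< _ _ _ = span l lo k y
  ... | tri≈ _ _ _ = lo , hi
  ... | tri> _ _ _ = span r (suc k) hi y

  span-root : span (node l k r) lo hi k ≡ (lo , hi)
  span-root {k = k} with <-cmp k k
  ... | tri< k<k _ _ = contradiction k<k (<-irrefl refl)
  ... | tri≈ _ _ _   = refl
  ... | tri> _ _ k<k = contradiction k<k (<-irrefl refl)

  span-left : y < k → span (node l k r) lo hi y ≡ span l lo k y
  span-left {y} {k} y<k with <-cmp y k
  ... | tri< _ _ _   = refl
  ... | tri≈ y≮k _ _ = contradiction y<k y≮k
  ... | tri> y≮k _ _ = contradiction y<k y≮k

  span-right : k < y → span (node l k r) lo hi y ≡ span r (suc k) hi y
  span-right {k} {y} k<y with <-cmp y k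
  ... | tri< _ _ y≯k = contradiction k<y y≯k
  ... | tri≈ _ _ y≯k = contradiction k<y y≯k
  ... | tri> _ _ _   = refl

  Spans-span : Within lo hi X → y ∈ inorder X →
               Spans X lo hi y (proj₁ (span X lo hi y)) (proj₂ (span X lo hi y))
  Spans-span {lo} {hi} {node l k r} {y} (node lo≤k k<hi wl wr) y∈ with ∈-++⁻ (inorder l) y∈
  ... | inj₁ y∈l rewrite span-left {l = l} {r} {lo} {hi} (proj₂ (Within-∈ wl y∈l)) =
    left (Spans-span wl y∈l)
  ... | inj₂ (here refl) rewrite span-root {l} {k} {r} {lo} {hi} = here
  ... | inj₂ (there y∈r) rewrite span-right {l = l} {r} {lo} {hi} (proj₁ (Within-∈ wr y∈r)) =
    right (Spans-span wr y∈r)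

  Spans-unique : Within lo hi X → Spans X lo hi y a b → span X lo hi y ≡ (a , b)
  Spans-unique (node {k = k} {l = l} {r = r} lo≤k k<hi wl wr) here = span-root {l} {k} {r}
  Spans-unique (node {l = l} {r = r} lo≤k k<hi wl wr) (left S) =
    trans (span-left {l = l} {r} (proj₂ (Within-∈ wl (Spans-∈ S)))) (Spans-unique wl S)
  Spans-unique (node {l = l} {r = r} lo≤k k<hi wl wr) (right S) =
    trans (span-right {l = l} {r} (proj₁ (Within-∈ wr (Spans-∈ S)))) (Spans-unique wr S)

  -- An interval also holds keys of pendent subtrees, which `ancestors X` does not trace; hence the
  -- separate hypothesis that `x` is a key of `X`.
  Spans-ancestor : Within lo hi X → Spans X lo hi y a b → x ∈ inorder X →
                   a ≤ x → x < b → x ≢ y → y ∈ ancestors X x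
  Spans-ancestor {X = node l k r} {x = x} (node lo≤k k<hi wl wr) S x∈ a≤x x<b x≢y
    with ∈-++⁻ (inorder l) x∈
  Spans-ancestor {X = node l k r} {x = x} (node lo≤k k<hi wl wr) S x∈ a≤x x<b x≢y | inj₁ x∈l
    = subst (_ ∈_) (sym (ancestors-left l k r x∈l)) (case S of λ where
      here       → here refl
      (left Sl)  → there (Spans-ancestor wl Sl x∈l a≤x x<b x≢y)
      (right Sr) → contradiction (<-trans (proj₂ (Within-∈ wl x∈l))
                     (<-≤-trans (proj₁ (Spans-bounds wr Sr)) a≤x)) (<-irrefl refl))
  Spans-ancestor {X = node l k r} {x = x} (node lo≤k k<hi wl wr) S x∈ a≤x x<b x≢y | inj₂ (here refl) =
    case S of λ where
      here       → contradiction refl x≢y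
      (left Sl)  → contradiction (<-≤-trans x<b (proj₂ (Spans-bounds wl Sl))) (<-irrefl refl)
      (right Sr) → contradiction (<-≤-trans (proj₁ (Spans-bounds wr Sr)) a≤x) (<-irrefl refl)
  Spans-ancestor {X = node l k r} {x = x} (node lo≤k k<hi wl wr) S x∈ a≤x x<b x≢y | inj₂ (there x∈r)
    = subst (_ ∈_) (sym (ancestors-right l k r (λ x∈l → <-asym (proj₂ (Within-∈ wl x∈l)) (proj₁ (Within-∈ wr x∈r))) x∈r))
    (case S of λ where
      here       → here refl
      (left Sl)  → contradiction (<-≤-trans (<-≤-trans x<b (proj₂ (Spans-bounds wl Sl)))
                     (<⇒≤ (proj₁ (Within-∈ wr x∈r)))) (<-irrefl refl)
      (right Sr) → there (Spans-ancestor wr Sr x∈r a≤x x<b x≢y))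

  -- Where the descents to `y` and `z` part, the key at that node separates the two intervals; where
  -- only one of them stops, its key is excluded from the lower interval.
  Spans-antisym : Within lo hi X → Spans X lo hi y a b → Spans X lo hi z c d →
                  a ≤ z → z < b → c ≤ y → y < d → y ≡ z
  Spans-antisym w here here _ _ _ _ = refl
  Spans-antisym (node lo≤k k<hi wl wr) here (left S) _ _ _ k<d =
    contradiction (<-≤-trans k<d (proj₂ (Spans-bounds wl S))) (<-irrefl refl)
  Spans-antisym (node lo≤k k<hi wl wr) here (right S) _ _ c≤k _ =
    contradiction (<-≤-trans (proj₁ (Spans-bounds wr S)) c≤k) (<-irrefl refl)
  Spans-antisym (node lo≤k k<hi wl wr) (left S) here _ k<b _ _ =
    contradiction (<-≤-trans k<b (proj₂ (Spans-bounds wl S))) (<-irrefl refl)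
  Spans-antisym (node lo≤k k<hi wl wr) (left S) (left S′) a≤z z<b c≤y y<d =
    Spans-antisym wl S S′ a≤z z<b c≤y y<d
  Spans-antisym (node lo≤k k<hi wl wr) (left S) (right S′) _ z<b _ _ =
    contradiction (<-trans (<-≤-trans z<b (proj₂ (Spans-bounds wl S)))
      (<-≤-trans (proj₁ (Spans-bounds wr S′)) (proj₁ (Spans-self wr S′)))) (<-irrefl refl)
  Spans-antisym (node lo≤k k<hi wl wr) (right S) here a≤k _ _ _ =
    contradiction (<-≤-trans (proj₁ (Spans-bounds wr S)) a≤k) (<-irrefl refl)
  Spans-antisym (node lo≤k k<hi wl wr) (right S) (left S′) _ _ _ y<d =
    contradiction (<-trans (<-≤-trans y<d (proj₂ (Spans-bounds wl S′)))
      (<-≤-trans (proj₁ (Spans-bounds wr S)) (proj₁ (Spans-self wr S)))) (<-irrefl refl)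
  Spans-antisym (node lo≤k k<hi wl wr) (right S) (right S′) a≤z z<b c≤y y<d =
    Spans-antisym wr S S′ a≤z z<b c≤y y<d

  record CommonAncestor (X : Tree) (lo hi x y : ℕ) : Set where
    field
      {anc from to} : ℕ
      spans         : Spans X lo hi anc from to
      x≤anc         : x ≤ anc
      anc≤y         : anc ≤ y
      from≤x        : from ≤ x
      y<to          : y < to

  -- The first node on the descent whose key falls between `x` and `y` is their lowest common
  -- ancestor: every cut above it leaves both on the same side, so its interval holds both.
  commonAncestor : Within lo hi X → x ∈ inorder X → y ∈ inorder X → x ≤ y → CommonAncestor X lo hi x y
  commonAncestor {lo} {hi} {node l k r} {x} {y} w@(node lo≤k k<hi wl wr) x∈ y∈ x≤y
    with ∈-++⁻ (inorder l) x∈ | ∈-++⁻ (inorder l) y∈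
  ... | inj₁ x∈l | inj₁ y∈l = record { CommonAncestor ca ; spans = left (CommonAncestor.spans ca) }
    where ca = commonAncestor wl x∈l y∈l x≤y
  ... | inj₂ (there x∈r) | inj₂ (there y∈r) = record { CommonAncestor ca ; spans = right (CommonAncestor.spans ca) }
    where ca = commonAncestor wr x∈r y∈r x≤y
  ... | inj₁ x∈l | inj₂ y∈kr = record
    { spans = here ; x≤anc = <⇒≤ (proj₂ (Within-∈ wl x∈l))
    ; anc≤y = case y∈kr of λ { (here refl) → ≤-refl ; (there y∈r) → <⇒≤ (proj₁ (Within-∈ wr y∈r)) }
    ; from≤x = proj₁ (Within-∈ w x∈) ; y<to = proj₂ (Within-∈ w y∈) }
  ... | inj₂ (here refl) | _ = record
    { spans = here ; x≤anc = ≤-refl ; anc≤y = x≤y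
    ; from≤x = proj₁ (Within-∈ w x∈) ; y<to = proj₂ (Within-∈ w y∈) }
  ... | inj₂ (there x∈r) | inj₁ y∈l =
    contradiction (<-≤-trans (<-trans (proj₂ (Within-∈ wl y∈l)) (proj₁ (Within-∈ wr x∈r))) x≤y) (<-irrefl refl)
  ... | inj₂ (there x∈r) | inj₂ (here refl) =
    contradiction (<-≤-trans (proj₁ (Within-∈ wr x∈r)) x≤y) (<-irrefl refl)

  -- Intervals below the root stay on one side of its key. Applied to the after-tree, this keeps the
  -- subtree of a path node other than `s` from straddling `s`.
  root-∉-Spans : Within lo hi X → root X ≡ [ s ] → Spans X lo hi y a b → a ≤ s → s < b → y ≡ s
  root-∉-Spans w refl here _ _ = refl
  root-∉-Spans (node lo≤k k<hi wl wr) refl (left S) _ s<b =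
    contradiction (<-≤-trans s<b (proj₂ (Spans-bounds wl S))) (<-irrefl refl)
  root-∉-Spans (node lo≤k k<hi wl wr) refl (right S) a≤s _ =
    contradiction (<-≤-trans (proj₁ (Spans-bounds wr S)) a≤s) (<-irrefl refl)

  Within-sorted : Within lo hi X → AllPairs _<_ (inorder X)
  Within-sorted leaf = []
  Within-sorted (node {k = k} lo≤k k<hi wl wr) = AllPairs.++⁺ (Within-sorted wl)
    (All.tabulate (proj₁ ∘ Within-∈ wr) ∷ Within-sorted wr)
    (All.tabulate λ x∈l → proj₂ (Within-∈ wl x∈l) ∷
      All.tabulate λ y∈r → <-trans (proj₂ (Within-∈ wl x∈l)) (proj₁ (Within-∈ wr y∈r)))

  -- Consecutive keys and refilled trees

  sorted-↭⇒≡ : Linked _<_ xs → Linked _<_ ys → xs ↭ ys → xs ≡ ys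
  sorted-↭⇒≡ xs↗ ys↗ xs↭ys = Pointwise-≡⇒≡
    (↗↭↗⇒≋ ≤-totalOrder (Linked.map <⇒≤ xs↗) (Linked.map <⇒≤ ys↗) (↭⇒↭ₛ xs↭ys))

  -- By `IsBST` the inorder list of each subtree of `T` consists of consecutive integers, so its two
  -- ends determine its weight.
  data Run : ℕ → ℕ → List ℕ → Set where
    []  : Run a a []
    [-]∷_ : Run (suc a) b xs → Run a b (a ∷ xs)

  Run-≤ : Run a b xs → a ≤ b
  Run-≤ []      = ≤-refl
  Run-≤ ([-]∷ R) = <⇒≤ (Run-≤ R)

  Run-++⁻ : ∀ xs → Run a b (xs ++ c ∷ ys) → Run a c xs × Run (suc c) b ys
  Run-++⁻ []       ([-]∷ R) = [] , R
  Run-++⁻ (x ∷ xs) ([-]∷ R) with R₁ , R₂ ← Run-++⁻ xs R = [-]∷ R₁ , R₂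

  Run-applyUpTo : ∀ (f : ℕ → ℕ) n → (∀ i → f (suc i) ≡ suc (f i)) → Run (f 0) (f n) (applyUpTo f n)
  Run-applyUpTo f zero    f-suc = []
  Run-applyUpTo f (suc n) f-suc = [-]∷ subst (λ a → Run a (f (suc n)) (applyUpTo (f ∘ suc) n)) (f-suc 0)
    (Run-applyUpTo (f ∘ suc) n (f-suc ∘ suc))

  Run-upTo : ∀ n → Run 0 n (upTo n)
  Run-upTo n = Run-applyUpTo (λ i → i) n (λ _ → refl)

  Run⇒Within : ∀ X → Run lo hi (inorder X) → Within lo hi X
  Run⇒Within leaf R = leaf
  Run⇒Within (node l k r) R with Rl , Rr ← Run-++⁻ (inorder l) R =
    node (Run-≤ Rl) (Run-≤ Rr) (Run⇒Within l Rl) (Run⇒Within r Rr)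

  -- flat ks ts interleaves the keys ks with the inorder lists of ts, and flat′
  -- does the same starting from a key.
  flat flat′ : List ℕ → List Tree → List ℕ
  flat ks []       = flat′ ks []
  flat ks (t ∷ ts) = inorder t ++ flat′ ks ts
  flat′ []       ts = []
  flat′ (k ∷ ks) ts = k ∷ flat ks ts

  -- The trailing keys `ks` and the trees left over by `fill` carry the induction: after the left
  -- subtree, the root and the right subtree remain to be interleaved.
  flat-fill : ∀ A ks ts → flat (inorder A ++ ks) ts ≡ inorder (proj₁ (fill A ts)) ++ flat′ ks (proj₂ (fill A ts))
  flat-fill leaf ks []       = refl
  flat-fill leaf ks (t ∷ ts) = refl
  flat-fill (node l k r) ks ts = begin
    flat ((inorder l ++ k ∷ inorder r) ++ ks) ts ≡⟨ cong (λ v → flat v ts) (++-assoc (inorder l) _ ks) ⟩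
    flat (inorder l ++ k ∷ inorder r ++ ks) ts   ≡⟨ flat-fill l (k ∷ inorder r ++ ks) ts ⟩
    l′ ++ k ∷ flat (inorder r ++ ks) ts₁         ≡⟨ cong (λ v → l′ ++ k ∷ v) (flat-fill r ks ts₁) ⟩
    l′ ++ k ∷ r′ ++ flat′ ks ts₂                 ≡⟨ ++-assoc l′ _ _ ⟨
    (l′ ++ k ∷ r′) ++ flat′ ks ts₂               ∎
    where
    open ≡-Reasoning
    l′ = inorder (proj₁ (fill l ts))
    ts₁ = proj₂ (fill l ts)
    r′ = inorder (proj₁ (fill r ts₁))
    ts₂ = proj₂ (fill r ts₁)

  -- The right-hand side sees `A` only through its inorder list, so trees with equal key lists give
  -- equal inorder lists after filling.
  inorder-fill : ∀ A ts → inorder (proj₁ (fill A ts)) ≡ flat (inorder A) ts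
  inorder-fill A ts = begin
    inorder (proj₁ (fill A ts))       ≡⟨ ++-identityʳ _ ⟨
    inorder (proj₁ (fill A ts)) ++ [] ≡⟨ flat-fill A [] ts ⟨
    flat (inorder A ++ []) ts         ≡⟨ cong (λ v → flat v ts) (++-identityʳ _) ⟩
    flat (inorder A) ts               ∎
    where open ≡-Reasoning

  Run-fill⇒Within : ∀ A ts → Run lo hi (inorder (proj₁ (fill A ts))) → Within lo hi A
  Run-fill⇒Within leaf ts R = leaf
  Run-fill⇒Within (node l k r) ts R
    with Rl , Rr ← Run-++⁻ (inorder (proj₁ (fill l ts))) R =
    node (Run-≤ Rl) (Run-≤ Rr) (Run-fill⇒Within l ts Rl) (Run-fill⇒Within r (proj₂ (fill l ts)) Rr)

  -- Orientation by side, and order along a list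

  _<[_]_ : ℕ → Bool → ℕ → Set
  p <[ true ]  q = p < q
  p <[ false ] q = q < p

  <[]-trans : ∀ σ → x <[ σ ] y → y <[ σ ] z → x <[ σ ] z
  <[]-trans true  x<y y<z = <-trans x<y y<z
  <[]-trans false y<x z<y = <-trans z<y y<x

  <[]-irrefl : ∀ σ → ¬ x <[ σ ] x
  <[]-irrefl true  = <-irrefl refl
  <[]-irrefl false = <-irrefl refl

  <[]-cmp : ∀ σ x y → Tri (x <[ σ ] y) (x ≡ y) (y <[ σ ] x)
  <[]-cmp true  x y = <-cmp x y
  <[]-cmp false x y with <-cmp y x
  ... | tri< y<x y≢x x≮y = tri< y<x (y≢x ∘ sym) x≮y
  ... | tri≈ y≮x y≡x x≮y = tri≈ y≮x (sym y≡x) x≮y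
  ... | tri> y≮x y≢x x<y = tri> y≮x (y≢x ∘ sym) x<y

  <[]-convex : ∀ σ → a ≤ x × x < b → a ≤ z × z < b → x <[ σ ] y → y <[ σ ] z → a ≤ y × y < b
  <[]-convex true  (a≤x , _) (_ , z<b) x<y y<z = ≤-trans a≤x (<⇒≤ x<y) , <-trans y<z z<b
  <[]-convex false (_ , x<b) (a≤z , _) y<x z<y = ≤-trans a≤z (<⇒≤ z<y) , <-trans y<x x<b

  data Before : List ℕ → ℕ → ℕ → Set where
    here  : q ∈ xs → Before (p ∷ xs) p q
    there : Before xs p q → Before (x ∷ xs) p q

  Before-∈ˡ : Before xs p q → p ∈ xs
  Before-∈ˡ (here _)  = here refl
  Before-∈ˡ (there B) = there (Before-∈ˡ B)

  Before-∈ʳ : Before xs p q → q ∈ xs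
  Before-∈ʳ (here q∈) = there q∈
  Before-∈ʳ (there B) = there (Before-∈ʳ B)

  Before-++⁺ : ∀ xs → p ∈ xs → q ∈ ys → Before (xs ++ ys) p q
  Before-++⁺ (x ∷ xs) (here refl) q∈ = here (∈-++⁺ʳ xs q∈)
  Before-++⁺ (x ∷ xs) (there p∈)  q∈ = there (Before-++⁺ xs p∈ q∈)

  AllPairs-Before : ∀ {R : ℕ → ℕ → Set} → AllPairs R xs → Before xs p q → R p q
  AllPairs-Before (Rx ∷ _) (here q∈) = All.lookup Rx q∈
  AllPairs-Before (_ ∷ Rs) (there B) = AllPairs-Before Rs B

  Before-trans : AllPairs _≢_ xs → Before xs x y → Before xs y z → Before xs x z
  Before-trans (_ ∷ _)   (here _)  (there B′) = here (Before-∈ʳ B′)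
  Before-trans (x≢ ∷ _)  (here y∈) (here _)   = contradiction refl (All.lookup x≢ y∈)
  Before-trans (x≢ ∷ _)  (there B) (here _)   = contradiction refl (All.lookup x≢ (Before-∈ʳ B))
  Before-trans (_ ∷ xs!) (there B) (there B′) = there (Before-trans xs! B B′)

  -- The search path and the tree it induces

  data EndsIn (s : ℕ) : List ℕ → Set where
    [-] : EndsIn s [ s ]
    _∷_ : ∀ x → EndsIn s xs → EndsIn s (x ∷ xs)

  EndsIn-∈ : EndsIn s xs → s ∈ xs
  EndsIn-∈ [-]     = here refl
  EndsIn-∈ (_ ∷ E) = there (EndsIn-∈ E)

  -- The condition that a path node `p` imposes on everything below it: keys lie past `p` in the
  -- direction of `s`. It is vacuous for `p = s`.
  Toward : ℕ → ℕ → ℕ → Set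
  Toward s p a = ∀ σ → p <[ σ ] s → p <[ σ ] a

  -- Path s T P ts X: the search path P of s in T, its pendent subtrees ts, and
  -- the tree X that T induces on P.
  data Path (s : ℕ) : Tree → List ℕ → List Tree → Tree → Set where
    stop  : Path s (node l s r) [ s ] (l ∷ r ∷ []) (node leaf s leaf)
    left  : s < k → Path s l P ts X → Path s (node l k r) (k ∷ P) (ts ++ [ r ]) (node X k leaf)
    right : k < s → Path s r P ts X → Path s (node l k r) (k ∷ P) (l ∷ ts) (node leaf k X)

  path : ∀ T → Within lo hi T → s ∈ inorder T → ∃ λ X → Path s T (searchPath T s) (pendants T s) X
  path {s = s} (node l k r) (node _ _ wl wr) s∈ with s <ᵇ k in s<ᵇk | k <ᵇ s in k<ᵇs
  ... | true | _ with ∈-++⁻ (inorder l) s∈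
  ...   | inj₁ s∈l = _ , left (<ᵇ⇒< s k (≡⇒T s<ᵇk)) (proj₂ (path l wl s∈l))
  ...   | inj₂ (here refl) = contradiction (<ᵇ⇒< s k (≡⇒T s<ᵇk)) (<-irrefl refl)
  ...   | inj₂ (there s∈r) = contradiction (<ᵇ⇒< s k (≡⇒T s<ᵇk)) (<-asym (proj₁ (Within-∈ wr s∈r)))
  path {s = s} (node l k r) (node _ _ wl wr) s∈ | false | true with ∈-++⁻ (inorder l) s∈
  ...   | inj₁ s∈l = contradiction (<ᵇ⇒< k s (≡⇒T k<ᵇs)) (<-asym (proj₂ (Within-∈ wl s∈l)))
  ...   | inj₂ (here refl) = contradiction (<ᵇ⇒< k s (≡⇒T k<ᵇs)) (<-irrefl refl)
  ...   | inj₂ (there s∈r) = _ , right (<ᵇ⇒< k s (≡⇒T k<ᵇs)) (proj₂ (path r wr s∈r))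
  path {s = s} (node l k r) (node _ _ wl wr) s∈ | false | false with <-cmp s k
  ... | tri< s<k _ _ = contradiction (trans (sym (T⇒≡ (<⇒<ᵇ s<k))) s<ᵇk) λ ()
  ... | tri≈ _ refl _ = _ , stop
  ... | tri> _ _ k<s = contradiction (trans (sym (T⇒≡ (<⇒<ᵇ k<s))) k<ᵇs) λ ()

  Path-⊆ : Path s A P ts X → x ∈ P → x ∈ inorder A
  Path-⊆ (stop {l}) (here refl) = ∈-insert (inorder l)
  Path-⊆ (left {l = l} _ π) (here refl) = ∈-insert (inorder l)
  Path-⊆ (left _ π) (there x∈P) = ∈-++⁺ˡ (Path-⊆ π x∈P)
  Path-⊆ (right {l = l} _ π) (here refl) = ∈-insert (inorder l)
  Path-⊆ (right {l = l} _ π) (there x∈P) = ∈-++⁺ʳ (inorder l) (there (Path-⊆ π x∈P))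

  Path-EndsIn : Path s A P ts X → EndsIn s P
  Path-EndsIn stop        = [-]
  Path-EndsIn (left _ π)  = _ ∷ Path-EndsIn π
  Path-EndsIn (right _ π) = _ ∷ Path-EndsIn π

  Path-inorder : Path s A P ts X → inorder X ↭ P
  Path-inorder stop        = ↭-refl
  Path-inorder (left {X = X} _ π)  = ↭-trans (++-comm (inorder X) _) (prep _ (Path-inorder π))
  Path-inorder (right _ π) = prep _ (Path-inorder π)

  -- The extra trees `us` absorb the `ts ++ [ r ]` of the left case, where the pendent subtree of
  -- the current node is consumed after those further down.
  Path-fill : Path s A P ts X → ∀ us → fill X (ts ++ us) ≡ (A , us)
  Path-fill stop us = refl
  Path-fill (left {ts = ts} {r = r} _ π) us
    rewrite ++-assoc ts [ r ] us | Path-fill π (r ∷ us) = refl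
  Path-fill (right _ π) us rewrite Path-fill π us = refl

  -- The search turns toward `s` at every path node, and all later ones lie in the subtree it
  -- enters. The conjunct `p ≢ s` records that `s` comes last; with `Toward` it excludes
  -- repetitions.
  Path-Toward : Within lo hi A → Path s A P ts X → AllPairs (λ p q → p ≢ s × Toward s p q) P
  Path-Toward _ stop = [] ∷ []
  Path-Toward (node _ _ wl _) (left s<k π) =
    All.tabulate (λ q∈ → (λ { refl → <-irrefl refl s<k }) , λ
      { true k<s → contradiction k<s (<-asym s<k)
      ; false _ → proj₂ (Within-∈ wl (Path-⊆ π q∈)) })
    ∷ Path-Toward wl π
  Path-Toward (node _ _ _ wr) (right k<s π) =
    All.tabulate (λ q∈ → (λ { refl → <-irrefl refl k<s }) , λ
      { true _ → proj₁ (Within-∈ wr (Path-⊆ π q∈))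
      ; false s<k → contradiction k<s (<-asym s<k) })
    ∷ Path-Toward wr π

  Path-root : ∀ {post} → Path s (node l k r) P ts X → P ≡ x ∷ post → x ≡ k
  Path-root stop        refl = refl
  Path-root (left _ _)  refl = refl
  Path-root (right _ _) refl = refl

  Path-ancestors : Within lo hi A → Path s A P ts X → ∀ pre {post} → P ≡ pre ++ x ∷ post → ancestors A x ≡ pre
  Path-ancestors {A = node l k r} (node _ _ wl wr) π [] e with refl ← Path-root π e =
    ancestors-root l k r (λ k∈l → <-irrefl refl (proj₂ (Within-∈ wl k∈l)))
                         (λ k∈r → <-irrefl refl (proj₁ (Within-∈ wr k∈r)))
  Path-ancestors w stop (_ ∷ []) ()
  Path-ancestors w stop (_ ∷ _ ∷ _) ()
  Path-ancestors {A = node l k r} (node _ _ wl wr) (left _ π) (_ ∷ pre) refl =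
    trans (ancestors-left l k r (Path-⊆ π (∈-insert pre))) (cong (k ∷_) (Path-ancestors wl π pre refl))
  Path-ancestors {A = node l k r} (node _ _ wl wr) (right _ π) (_ ∷ pre) refl =
    trans (ancestors-right l k r (λ x∈l → <-asym (proj₂ (Within-∈ wl x∈l)) (proj₁ (Within-∈ wr x∈r))) x∈r)
          (cong (k ∷_) (Path-ancestors wr π pre refl))
    where x∈r = Path-⊆ π (∈-insert pre)

  Path-ancestor⇒Before : Within lo hi A → Path s A P ts X → x ∈ P → y ∈ ancestors A x → Before P y x
  Path-ancestor⇒Before w π x∈P y∈ with pre , post , refl ← ∈-∃++ x∈P =
    Before-++⁺ pre (subst (_ ∈_) (Path-ancestors w π pre refl) y∈) (here refl)

  -- Together with `Toward⇒Path-span` this describes the interval of `z` as the keys past all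
  -- earlier path nodes, so containments between subtrees of `T` can be tested one path node at a
  -- time.
  Path-span⇒Toward : Within lo hi X → Path s A P ts X → Before P p z → Spans X lo hi z a b →
                     a ≤ c → c < b → Toward s p c
  Path-span⇒Toward (node _ _ wx _) (left s<k π) (here z∈) S a≤c c<b true k<s = contradiction k<s (<-asym s<k)
  Path-span⇒Toward (node _ _ wx _) (left s<k π) (here z∈) here a≤c c<b false _ =
    contradiction (proj₂ (Within-∈ wx (∈-resp-↭ (↭-sym (Path-inorder π)) z∈))) (<-irrefl refl)
  Path-span⇒Toward (node _ _ wx _) (left s<k π) (here z∈) (left S) a≤c c<b false _ =
    <-≤-trans c<b (proj₂ (Spans-bounds wx S))
  Path-span⇒Toward (node _ _ wx _) (left s<k π) (there B) here a≤c c<b =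
    contradiction (proj₂ (Within-∈ wx (∈-resp-↭ (↭-sym (Path-inorder π)) (Before-∈ʳ B)))) (<-irrefl refl)
  Path-span⇒Toward (node _ _ wx _) (left s<k π) (there B) (left S) a≤c c<b = Path-span⇒Toward wx π B S a≤c c<b
  Path-span⇒Toward (node _ _ _ wx) (right k<s π) (here z∈) S a≤c c<b false s<k = contradiction k<s (<-asym s<k)
  Path-span⇒Toward (node _ _ _ wx) (right k<s π) (here z∈) here a≤c c<b true _ =
    contradiction (proj₁ (Within-∈ wx (∈-resp-↭ (↭-sym (Path-inorder π)) z∈))) (<-irrefl refl)
  Path-span⇒Toward (node _ _ _ wx) (right k<s π) (here z∈) (right S) a≤c c<b true _ =
    <-≤-trans (proj₁ (Spans-bounds wx S)) a≤c
  Path-span⇒Toward (node _ _ _ wx) (right k<s π) (there B) here a≤c c<b =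
    contradiction (proj₁ (Within-∈ wx (∈-resp-↭ (↭-sym (Path-inorder π)) (Before-∈ʳ B)))) (<-irrefl refl)
  Path-span⇒Toward (node _ _ _ wx) (right k<s π) (there B) (right S) a≤c c<b = Path-span⇒Toward wx π B S a≤c c<b

  Toward⇒Path-span : Path s A P ts X → Spans X lo hi z a b → lo ≤ c → c < hi →
                     (∀ {p} → Before P p z → Toward s p c) → a ≤ c × c < b
  Toward⇒Path-span stop here lo≤c c<hi _ = lo≤c , c<hi
  Toward⇒Path-span (left _ π) here lo≤c c<hi _ = lo≤c , c<hi
  Toward⇒Path-span (left s<k π) (left S) lo≤c c<hi t =
    Toward⇒Path-span π S lo≤c (t (here (∈-resp-↭ (Path-inorder π) (Spans-∈ S))) false s<k) (t ∘ there)
  Toward⇒Path-span (right _ π) here lo≤c c<hi _ = lo≤c , c<hi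
  Toward⇒Path-span (right k<s π) (right S) lo≤c c<hi t =
    Toward⇒Path-span π S (t (here (∈-resp-↭ (Path-inorder π) (Spans-∈ S))) true k<s) c<hi (t ∘ there)

  -- Positions and counts in filtered lists

  nth : ℕ → List ℕ → ℕ → ℕ
  nth d []       i       = d
  nth d (x ∷ xs) zero    = x
  nth d (x ∷ xs) (suc i) = nth d xs i

  module _ {f : ℕ → Bool} where

    filterᵇ-⊆ : ∀ xs → x ∈ filterᵇ f xs → x ∈ xs × f x ≡ true
    filterᵇ-⊆ (y ∷ xs) x∈ with f y in fy
    filterᵇ-⊆ (y ∷ xs) (here refl) | true  = here refl , fy
    filterᵇ-⊆ (y ∷ xs) (there x∈)  | true  with x∈xs , fx ← filterᵇ-⊆ xs x∈ = there x∈xs , fx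
    filterᵇ-⊆ (y ∷ xs) x∈          | false with x∈xs , fx ← filterᵇ-⊆ xs x∈ = there x∈xs , fx

    nth-∈ : ∀ {i d} xs → i < length xs → nth d xs i ∈ xs
    nth-∈ {zero}  (x ∷ xs) _         = here refl
    nth-∈ {suc i} (x ∷ xs) (s≤s i<n) = there (nth-∈ xs i<n)

    nth-filterᵇ-∈ : EndsIn s P → ∀ i → nth s (filterᵇ f P) i ∈ P
    nth-filterᵇ-∈ {s} ([-]) i with f s
    nth-filterᵇ-∈ [-] zero    | true  = here refl
    nth-filterᵇ-∈ [-] (suc i) | true  = here refl
    nth-filterᵇ-∈ [-] i       | false = here refl
    nth-filterᵇ-∈ (y ∷ E) i with f y
    nth-filterᵇ-∈ (y ∷ E) zero    | true  = here refl
    nth-filterᵇ-∈ (y ∷ E) (suc i) | true  = there (nth-filterᵇ-∈ E i)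
    nth-filterᵇ-∈ (y ∷ E) i       | false = there (nth-filterᵇ-∈ E i)

    -- `s` ends the path and fails `f`, so the default value of `nth` is a genuine later path node,
    -- and `j` may run past the end of the filtered list.
    nth-filterᵇ-Before : EndsIn s P → f s ≡ false → ∀ {i j} → i < j → i < length (filterᵇ f P) →
                         Before P (nth s (filterᵇ f P) i) (nth s (filterᵇ f P) j)
    nth-filterᵇ-Before [-] fs i<j i<n rewrite fs with () ← i<n
    nth-filterᵇ-Before (y ∷ E) fs {i} {j} i<j i<n with f y
    nth-filterᵇ-Before (y ∷ E) fs {zero}  {suc j} i<j i<n       | true  = here (nth-filterᵇ-∈ E j)
    nth-filterᵇ-Before (y ∷ E) fs {suc i} {suc j} (s≤s i<j) (s≤s i<n) | true  = there (nth-filterᵇ-Before E fs i<j i<n)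
    nth-filterᵇ-Before (y ∷ E) fs i<j i<n | false = there (nth-filterᵇ-Before E fs i<j i<n)

    ∈-nth-filterᵇ : ∀ {d} P → p ∈ P → f p ≡ true → ∃ λ i → i < length (filterᵇ f P) × nth d (filterᵇ f P) i ≡ p
    ∈-nth-filterᵇ (y ∷ P) p∈ fp with f y in fy
    ∈-nth-filterᵇ (y ∷ P) (here refl) fp | true = 0 , s≤s z≤n , refl
    ∈-nth-filterᵇ (y ∷ P) (there p∈)  fp | true with i , i<n , e ← ∈-nth-filterᵇ P p∈ fp = suc i , s≤s i<n , e
    ∈-nth-filterᵇ (y ∷ P) (here refl) fp | false = case trans (sym fp) fy of λ ()
    ∈-nth-filterᵇ (y ∷ P) (there p∈)  fp | false = ∈-nth-filterᵇ P p∈ fp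

  count-block : ∀ (g : ℕ → Bool) d xs {i j} → i ≤ length xs →
                (∀ k → j ≤ k → k < i → g (nth d xs k) ≡ true) → i ≤ j + count g xs
  count-block g d xs {zero} _ _ = z≤n
  count-block g d (x ∷ xs) {suc i} {zero} (s≤s i≤n) all with g x | all 0 z≤n (s≤s z≤n)
  ... | true | refl = s≤s (count-block g d xs {j = zero} i≤n λ k _ k<i → all (suc k) z≤n (s≤s k<i))
  count-block g d (x ∷ xs) {suc i} {suc j} (s≤s i≤n) all = s≤s (≤-trans
    (count-block g d xs {j = j} i≤n λ k j≤k k<i → all (suc k) (s≤s j≤k) (s≤s k<i))
    (+-monoʳ-≤ j count-≤-∷))
    where
    count-≤-∷ : count g xs ≤ count g (x ∷ xs)
    count-≤-∷ with g x
    ... | true  = n≤1+n _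
    ... | false = ≤-refl

  count-filterᵇ-≤ : ∀ (g f : ℕ → Bool) xs → count g (filterᵇ f xs) ≤ count g xs
  count-filterᵇ-≤ g f [] = z≤n
  count-filterᵇ-≤ g f (x ∷ xs) with f x
  count-filterᵇ-≤ g f (x ∷ xs) | true with g x
  ... | true  = s≤s (count-filterᵇ-≤ g f xs)
  ... | false = count-filterᵇ-≤ g f xs
  count-filterᵇ-≤ g f (x ∷ xs) | false with g x
  ... | true  = m≤n⇒m≤1+n (count-filterᵇ-≤ g f xs)
  ... | false = count-filterᵇ-≤ g f xs

  ≤⇒≡⊎< : p ≤ q → p ≡ q ⊎ p < q
  ≤⇒≡⊎< p≤q with m≤n⇒m<n∨m≡n p≤q
  ... | inj₁ p<q = inj₂ p<q
  ... | inj₂ p≡q = inj₁ p≡q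

  -- Subtrees of one side before and after the access

  side : Bool → ℕ → ℕ → Bool
  side true  s p = p <ᵇ s
  side false s p = s <ᵇ p

  side⇒< : ∀ σ → side σ s p ≡ true → p <[ σ ] s
  side⇒< {s} {p} true  e = <ᵇ⇒< p s (≡⇒T e)
  side⇒< {s} {p} false e = <ᵇ⇒< s p (≡⇒T e)

  <⇒side : ∀ σ → p <[ σ ] s → side σ s p ≡ true
  <⇒side true  p<s = T⇒≡ (<⇒<ᵇ p<s)
  <⇒side false s<p = T⇒≡ (<⇒<ᵇ s<p)

  ≯⇒side : ∀ σ → ¬ p <[ σ ] s → side σ s p ≡ false
  ≯⇒side {p} {s} σ p≮s with side σ s p in e
  ... | true  = contradiction (side⇒< σ e) p≮s
  ... | false = refl

  side-irrefl : ∀ σ → side σ s s ≡ false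
  side-irrefl σ = ≯⇒side σ (<[]-irrefl σ)

  gained : Tree → Tree → ℕ → ℕ → Bool
  gained T A y x = (y ∈ᵇ ancestors A x) ∧ not (y ∈ᵇ ancestors T x)

  _∈ᴵ_ : ℕ → ℕ × ℕ → Set
  c ∈ᴵ I = proj₁ I ≤ c × c < proj₂ I

  <[]-side : ∀ σ τ → p <[ σ ] s → p <[ τ ] s → σ ≡ τ
  <[]-side true  true  _ _ = refl
  <[]-side true  false p<s s<p = contradiction p<s (<-asym s<p)
  <[]-side false true  s<p p<s = contradiction p<s (<-asym s<p)
  <[]-side false false _ _ = refl

  module OneSide {n s D T A X P ts}
    (wT : Within 0 n T) (π : Path s T P ts X) (wX : Within 0 n X)
    (wA : Within 0 n A) (A↭P : inorder A ↭ P) (rootA : root A ≡ [ s ])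
    (gain≤D : ∀ y → y ∈ P → y ≢ s → count (gained T A y) P ≤ D)
    (σ : Bool) where

    B C : ℕ → ℕ × ℕ
    B y = span X 0 n y
    C y = span A 0 n y

    nodes : List ℕ
    nodes = filterᵇ (side σ s) P

    -- Indices past the last node of the side yield `s`, whose subtree in `T` still weighs at least
    -- `w s`. This gives `node# (suc (i + D))` a meaning for the bottom nodes too.
    node# : ℕ → ℕ
    node# = nth s nodes

    toward : Before P p q → p ≢ s × Toward s p q
    toward = AllPairs-Before (Path-Toward wT π)

    unique : AllPairs _≢_ P
    unique = AllPairs.map (λ { {p} (p≢s , t) refl → lemma p p≢s t }) (Path-Toward wT π)
      where
      lemma : ∀ p → p ≢ s → ¬ Toward s p p
      lemma p p≢s t with <-cmp p s
      ... | tri< p<s _ _ = <-irrefl refl (t true p<s)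
      ... | tri≈ _ e _   = p≢s e
      ... | tri> _ _ s<p = <-irrefl refl (t false s<p)

    spansB : p ∈ P → Spans X 0 n p (proj₁ (B p)) (proj₂ (B p))
    spansB p∈P = Spans-span wX (∈-resp-↭ (↭-sym (Path-inorder π)) p∈P)

    inA : p ∈ P → p ∈ inorder A
    inA = ∈-resp-↭ (↭-sym A↭P)

    spansC : p ∈ P → Spans A 0 n p (proj₁ (C p)) (proj₂ (C p))
    spansC p∈P = Spans-span wA (inA p∈P)

    node∈P : ∀ i → node# i ∈ P
    node∈P = nth-filterᵇ-∈ (Path-EndsIn π)

    node-side : ∀ {i} → i < length nodes → node# i <[ σ ] s
    node-side i<a = side⇒< σ (proj₂ (filterᵇ-⊆ P (nth-∈ {f = side σ s} nodes i<a)))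

    node-Before : ∀ {i j} → i < j → i < length nodes → Before P (node# i) (node# j)
    node-Before = nth-filterᵇ-Before (Path-EndsIn π) (side-irrefl σ)

    node-< : ∀ {i j} → i < j → i < length nodes → node# i <[ σ ] node# j
    node-< i<j i<a = proj₂ (toward (node-Before i<j i<a)) σ (node-side i<a)

    node-<⁻ : ∀ {i j} → i < length nodes → j < length nodes → node# i <[ σ ] node# j → i < j
    node-<⁻ {i} {j} i<a j<a lt with <-cmp i j
    ... | tri< i<j _ _ = i<j
    ... | tri≈ _ refl _ = contradiction lt (<[]-irrefl σ)
    ... | tri> _ _ j<i = contradiction (<[]-trans σ lt (node-< j<i j<a)) (<[]-irrefl σ)

    find : p ∈ P → p <[ σ ] s → ∃ λ i → i < length nodes × node# i ≡ p
    find p∈P p<s = ∈-nth-filterᵇ P p∈P (<⇒side σ p<s)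

    self∈C : p ∈ P → p ∈ᴵ C p
    self∈C p∈P = Spans-self wA (spansC p∈P)

    s∉C : p ∈ P → p ≢ s → ¬ s ∈ᴵ C p
    s∉C p∈P p≢s (≤s , s<) = p≢s (root-∉-Spans wA rootA (spansC p∈P) ≤s s<)

    node≢s : ∀ {i} → i < length nodes → node# i ≢ s
    node≢s i<a e = <[]-irrefl σ (subst (_<[ σ ] s) e (node-side i<a))

    -- If a key beyond `s` belonged to the subtree, convexity would put `s` itself there.
    C⇒side : ∀ {i c} → i < length nodes → c ∈ᴵ C (node# i) → c <[ σ ] s
    C⇒side {i} {c} i<a c∈ with <[]-cmp σ c s
    ... | tri< c<s _ _ = c<s
    ... | tri≈ _ refl _ = contradiction c∈ (s∉C (node∈P i) (node≢s i<a))
    ... | tri> _ _ s<c = contradiction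
      (<[]-convex σ (self∈C (node∈P i)) c∈ (node-side i<a) s<c) (s∉C (node∈P i) (node≢s i<a))

    -- All nodes between the two are gained as descendants.
    gain-near : ∀ {i j} → j ≤ i → i < length nodes → node# j ∈ᴵ C (node# i) → i ≤ j + D
    gain-near {i} {j} j≤i i<a xⱼ∈ = ≤-trans
      (count-block (gained T A (node# i)) s nodes (<⇒≤ i<a) all-gained)
      (+-monoʳ-≤ j (≤-trans (count-filterᵇ-≤ (gained T A (node# i)) (side σ s) P)
                            (gain≤D (node# i) (node∈P i) (node≢s i<a))))
      where
      inC : ∀ k → j ≤ k → k < i → node# k ∈ᴵ C (node# i)
      inC k j≤k k<i with m≤n⇒m<n∨m≡n j≤k
      ... | inj₂ refl = xⱼ∈
      ... | inj₁ j<k  = <[]-convex σ xⱼ∈ (self∈C (node∈P i))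
        (node-< j<k (<-trans j<k (<-trans k<i i<a))) (node-< k<i (<-trans k<i i<a))

      all-gained : ∀ k → j ≤ k → k < i → gained T A (node# i) (node# k) ≡ true
      all-gained k j≤k k<i = cong₂ (λ u v → u ∧ not v)
        (∈⇒∈ᵇ (Spans-ancestor wA (spansC (node∈P i)) (inA (node∈P k))
          (proj₁ (inC k j≤k k<i)) (proj₂ (inC k j≤k k<i))
          (λ e → <[]-irrefl σ (subst (_<[ σ ] node# i) e (node-< k<i k<a)))))
        (∉⇒∈ᵇ λ xᵢ∈ → <[]-irrefl σ (<[]-trans σ (node-< k<i k<a)
          (proj₂ (toward (Path-ancestor⇒Before wT π (node∈P k) xᵢ∈)) σ (node-side i<a))))
        where k<a = <-trans k<i i<a

    C-in-range : ∀ {c} → p ∈ P → c ∈ᴵ C p → c < n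
    C-in-range p∈P c∈ = <-≤-trans (proj₂ c∈) (proj₂ (Spans-bounds wA (spansC p∈P)))

    B-intro : ∀ {c} → p ∈ P → c < n → (∀ {q} → Before P q p → Toward s q c) → c ∈ᴵ B p
    B-intro p∈P c<n = Toward⇒Path-span π (spansB p∈P) z≤n c<n

    B-elim : ∀ {c} → Before P q p → c ∈ᴵ B p → Toward s q c
    B-elim q<p c∈ = Path-span⇒Toward wX π q<p (spansB (Before-∈ʳ q<p)) (proj₁ c∈) (proj₂ c∈)

    B-antitone : ∀ {i j c} → i < j → i < length nodes → c ∈ᴵ B (node# j) → c ∈ᴵ B (node# i)
    B-antitone {i} {j} i<j i<a c∈ = B-intro (node∈P i)
      (<-≤-trans (proj₂ c∈) (proj₂ (Spans-bounds wX (spansB (node∈P j)))))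
      (λ q<i → B-elim (Before-trans unique q<i (node-Before i<j i<a)) c∈)

    -- Only a node `q` of the same side, above `node# i`, could separate `c` from that subtree. By
    -- convexity `q` would then lie in the after-subtree of `node# (i + D)`, more than `D` positions
    -- below it, against `gain-near`.
    C⊆B-shifted : ∀ {i c} → i + D < length nodes → c ∈ᴵ C (node# (i + D)) → c ∈ᴵ B (node# i)
    C⊆B-shifted {i} {c} i+D<a c∈ = B-intro (node∈P i) (C-in-range (node∈P (i + D)) c∈) toward-c
      where
      c<s : c <[ σ ] s
      c<s = C⇒side i+D<a c∈

      i<a : i < length nodes
      i<a = ≤-<-trans (m≤m+n i D) i+D<a

      too-far : ∀ {q} → Before P q (node# i) → q <[ σ ] s → ¬ q ∈ᴵ C (node# (i + D))
      too-far q<i q<s q∈ with k , k<a , refl ← find (Before-∈ˡ q<i) q<s =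
        <-irrefl refl (<-≤-trans k<i (+-cancelʳ-≤ D i k
          (gain-near (≤-trans (<⇒≤ k<i) (m≤m+n i D)) i+D<a q∈)))
        where k<i = node-<⁻ k<a i<a (proj₂ (toward q<i) σ q<s)

      toward-c : ∀ {q} → Before P q (node# i) → Toward s q c
      toward-c {q} q<i τ q<s with <[]-cmp τ q c
      ... | tri< q<c _ _ = q<c
      ... | tri≈ _ refl _ = contradiction c∈ (too-far q<i c<s)
      ... | tri> _ _ c<q with refl ← <[]-side τ σ (<[]-trans τ c<q q<s) c<s
                         with k , k<a , refl ← find (Before-∈ˡ q<i) q<s =
        contradiction (<[]-convex σ c∈ (self∈C (node∈P (i + D))) c<q
                        (node-< (<-≤-trans (node-<⁻ k<a i<a (proj₂ (toward q<i) σ q<s)) (m≤m+n i D)) k<a))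
                      (too-far q<i q<s)

    -- The oriented form of `commonAncestor`. The endpoint cases are kept apart because `x ≡ q`
    -- makes `x` an ancestor of `y` in the after-tree, which a loser excludes.
    between : ∀ {x y} → x ∈ P → y ∈ P → x <[ σ ] y →
              ∃ λ q → q ∈ P × (x ≡ q ⊎ x <[ σ ] q) × (q ≡ y ⊎ q <[ σ ] y) × x ∈ᴵ C q × y ∈ᴵ C q
    between {x} {y} x∈P y∈P x<y = go σ x<y
      where
      open CommonAncestor

      in-P : ∀ {u v} (ca : CommonAncestor A 0 n u v) → anc ca ∈ P
      in-P ca = ∈-resp-↭ A↭P (Spans-∈ (spans ca))

      unique-C : ∀ {u v} (ca : CommonAncestor A 0 n u v) → C (anc ca) ≡ (from ca , to ca)
      unique-C ca = Spans-unique wA (spans ca)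

      go : ∀ σ → x <[ σ ] y →
           ∃ λ q → q ∈ P × (x ≡ q ⊎ x <[ σ ] q) × (q ≡ y ⊎ q <[ σ ] y) × x ∈ᴵ C q × y ∈ᴵ C q
      go true x<y =
        anc ca , in-P ca , ≤⇒≡⊎< (x≤anc ca) , ≤⇒≡⊎< (anc≤y ca) ,
        subst (x ∈ᴵ_) (sym (unique-C ca)) (from≤x ca , <-trans x<y (y<to ca)) ,
        subst (y ∈ᴵ_) (sym (unique-C ca)) (≤-trans (from≤x ca) (<⇒≤ x<y) , y<to ca)
        where ca = commonAncestor wA (inA x∈P) (inA y∈P) (<⇒≤ x<y)
      go false y<x =
        anc ca , in-P ca , Sum.map₁ sym (≤⇒≡⊎< (anc≤y ca)) , Sum.map₁ sym (≤⇒≡⊎< (x≤anc ca)) ,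
        subst (x ∈ᴵ_) (sym (unique-C ca)) (≤-trans (from≤x ca) (<⇒≤ y<x) , y<to ca) ,
        subst (y ∈ᴵ_) (sym (unique-C ca)) (from≤x ca , <-trans y<x (y<to ca))
        where ca = commonAncestor wA (inA y∈P) (inA x∈P) (<⇒≤ y<x)

    -- The lowest common ancestor q of x = node# i and z in the after-tree gains x,
    -- so it lies at most D positions below x, and q bounds the keys below x.
    lost-disjoint : ∀ {i c z} → i < length nodes → z ∈ P → z <[ σ ] s → node# i <[ σ ] z →
                    node# i ∉ ancestors A z → c ∈ᴵ C (node# i) → ¬ c ∈ᴵ B (node# (suc (i + D)))
    lost-disjoint {i} {c} {z} i<a z∈P z<s x<z x∉ c∈C c∈B
      with between (node∈P i) z∈P x<z
    ... | q , q∈P , inj₁ refl , _ , _ , z∈q =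
      x∉ (Spans-ancestor wA (spansC q∈P) (inA z∈P) (proj₁ z∈q) (proj₂ z∈q)
           (λ e → <[]-irrefl σ (subst (node# i <[ σ ]_) e x<z)))
    ... | q , q∈P , inj₂ x<q , q≤z , x∈q , z∈q
      with r , r<a , refl ← find q∈P (case q≤z of λ { (inj₁ refl) → z<s ; (inj₂ q<z) → <[]-trans σ q<z z<s }) =
      <[]-irrefl σ (subst (node# i <[ σ ]_) (sym x≡q) x<q)
      where
      r≤i+D : r ≤ i + D
      r≤i+D = gain-near (<⇒≤ (node-<⁻ i<a r<a x<q)) r<a x∈q

      -- The successor in `suc (i + D)` makes `node# r` strictly earlier on the path than the node
      -- whose subtree holds `c`. So `node# r` lies between `node# i` and `c`, and convexity pulls
      -- it into the after-subtree of `node# i`, although it is an ancestor of that node.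
      q<c : node# r <[ σ ] c
      q<c = B-elim (node-Before (s≤s r≤i+D) r<a) c∈B σ (node-side r<a)

      q∈C : node# r ∈ᴵ C (node# i)
      q∈C = <[]-convex σ (self∈C (node∈P i)) c∈C x<q q<c

      x≡q : node# i ≡ node# r
      x≡q = Spans-antisym wA (spansC (node∈P i)) (spansC q∈P) (proj₁ q∈C) (proj₂ q∈C) (proj₁ x∈q) (proj₂ x∈q)

  -- Counting the losers of the majority side

  module _ (f : ℕ → Bool) where

    length-filterᵇ : ∀ xs → length (filterᵇ f xs) ≡ count f xs
    length-filterᵇ [] = refl
    length-filterᵇ (x ∷ xs) with f x
    ... | true  = cong suc (length-filterᵇ xs)
    ... | false = length-filterᵇ xs

    count-++ : ∀ xs ys → count f (xs ++ ys) ≡ count f xs + count f ys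
    count-++ [] ys = refl
    count-++ (x ∷ xs) ys with f x
    ... | true  = cong suc (count-++ xs ys)
    ... | false = count-++ xs ys

    count-complement : ∀ xs → count f xs + count (not ∘ f) xs ≡ length xs
    count-complement [] = refl
    count-complement (x ∷ xs) with f x
    ... | true  = cong suc (count-complement xs)
    ... | false = trans (+-suc _ _) (cong suc (count-complement xs))

    count-zero : count f xs ≡ 0 → x ∈ xs → f x ≡ false
    count-zero {y ∷ xs} e x∈ with f y in fy
    count-zero {y ∷ xs} ()  _           | true
    count-zero {y ∷ xs} e   (here refl) | false = fy
    count-zero {y ∷ xs} e   (there x∈)  | false = count-zero e x∈

    -- With `f` the test for a side, the cut is at the deepest path node of that side, which has all
    -- other nodes of the side among its ancestors.
    last-true : ∀ xs → count f xs ≡ 0 ⊎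
                ∃ λ pre → ∃₂ λ x post → xs ≡ pre ++ x ∷ post × f x ≡ true × count f post ≡ 0
    last-true [] = inj₁ refl
    last-true (x ∷ xs) with last-true xs
    ... | inj₂ (pre , y , post , refl , fy , e) = inj₂ (x ∷ pre , y , post , refl , fy , e)
    ... | inj₁ e with f x in fx
    ...   | true  = inj₂ ([] , x , xs , refl , fx , e)
    ...   | false = inj₁ e

    -- Entries failing `f` are charged wholesale, whether or not they satisfy `g`. This is how lost
    -- ancestors on the other side are accounted for.
    count-≤-filterᵇ : ∀ (g h : ℕ → Bool) xs → (∀ {x} → x ∈ xs → g x ≡ true → h x ≡ true) →
                      count g xs ≤ count h (filterᵇ f xs) + count (not ∘ f) xs
    count-≤-filterᵇ g h [] g⇒h = z≤n
    count-≤-filterᵇ g h (x ∷ xs) g⇒h with f x | g x in gx | count-≤-filterᵇ g h xs (g⇒h ∘ there)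
    ... | false | true  | ih = ≤-trans (s≤s ih) (≤-reflexive (sym (+-suc _ _)))
    ... | false | false | ih = ≤-trans ih (+-monoʳ-≤ _ (n≤1+n _))
    ... | true  | true  | ih rewrite g⇒h (here refl) gx = s≤s ih
    ... | true  | false | ih with h x
    ...   | true  = m≤n⇒m≤1+n ih
    ...   | false = ih

  count-never : ∀ xs → count (λ _ → false) xs ≡ 0
  count-never []       = refl
  count-never (x ∷ xs) = count-never xs

  length-sides : ∀ {n T ts X} → Within 0 n T → Path s T P ts X →
                 length P ≡ suc (length (filterᵇ (side true s) P) + length (filterᵇ (side false s) P))
  length-sides {s} wT π = go (Path-EndsIn π) (Path-Toward wT π)
    where
    go : ∀ {P} → EndsIn s P → AllPairs (λ p q → p ≢ s × Toward s p q) P →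
         length P ≡ suc (length (filterᵇ (side true s) P) + length (filterᵇ (side false s) P))
    go [-] _ rewrite side-irrefl {s} true = refl
    go (x ∷ E) (rx ∷ r) with <[]-cmp true x s
    ... | tri< x<s _ _ rewrite <⇒side true x<s | ≯⇒side false (<-asym x<s) = cong suc (go E r)
    ... | tri≈ _ x≡s _ = contradiction x≡s (proj₁ (All.lookup rx (EndsIn-∈ E)))
    ... | tri> _ _ s<x rewrite ≯⇒side true (<-asym s<x) | <⇒side false s<x =
      cong suc (trans (go E r) (sym (+-suc _ _)))

  -- Here `a` and `b` count the ancestors on the own and on the other side, and `ℓ` the losers. The
  -- first hypothesis amounts to `2a + 2b ≤ 2qℓ + q(b - a) + 2qc`; the majority bound `b ≤ 2 + a`
  -- caps `q(b - a)` by `2q`, and `m ≤ 3 + 2a` passes to the path length.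
  loss-arithmetic : ∀ q a b c ℓ m → q * (a + b) + 2 * (a + b) ≤ 2 * q * (ℓ + b + c) → b ≤ 2 + a →
                    m ≤ 3 + 2 * a → m ≤ 2 * q * ℓ + (2 * q * c + 2 * q + 3)
  loss-arithmetic q a b c ℓ m h b≤ m≤ = ≤-trans m≤ (begin
    3 + 2 * a                                 ≤⟨ +-monoʳ-≤ 3 2a≤ ⟩
    3 + (2 * q * ℓ + (2 * q * c + 2 * q))
      ≡⟨ solve 3 (λ q ℓ c → con 3 :+ (con 2 :* q :* ℓ :+ (con 2 :* q :* c :+ con 2 :* q))
           := con 2 :* q :* ℓ :+ (con 2 :* q :* c :+ con 2 :* q :+ con 3)) refl q ℓ c ⟩
    2 * q * ℓ + (2 * q * c + 2 * q + 3)       ∎)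
    where
    open ≤-Reasoning
    open +-*-Solver
    2a≤ : 2 * a ≤ 2 * q * ℓ + (2 * q * c + 2 * q)
    2a≤ = +-cancelˡ-≤ (q * a + q * b) _ _ (begin
      q * a + q * b + 2 * a                 ≤⟨ m≤m+n _ (2 * b) ⟩
      q * a + q * b + 2 * a + 2 * b
        ≡⟨ solve 3 (λ q a b → q :* a :+ q :* b :+ con 2 :* a :+ con 2 :* b
             := q :* (a :+ b) :+ con 2 :* (a :+ b)) refl q a b ⟩
      q * (a + b) + 2 * (a + b)             ≤⟨ h ⟩
      2 * q * (ℓ + b + c)
        ≡⟨ solve 4 (λ q b c ℓ → con 2 :* q :* (ℓ :+ b :+ c)
             := q :* b :+ (q :* b :+ con 2 :* q :* ℓ :+ con 2 :* q :* c)) refl q b c ℓ ⟩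
      q * b + (q * b + 2 * q * ℓ + 2 * q * c)  ≤⟨ +-monoˡ-≤ _ (*-monoʳ-≤ q b≤) ⟩
      q * (2 + a) + (q * b + 2 * q * ℓ + 2 * q * c)
        ≡⟨ solve 5 (λ q a b c ℓ → q :* (con 2 :+ a) :+ (q :* b :+ con 2 :* q :* ℓ :+ con 2 :* q :* c)
             := q :* a :+ q :* b :+ (con 2 :* q :* ℓ :+ (con 2 :* q :* c :+ con 2 :* q))) refl q a b c ℓ ⟩
      q * a + q * b + (2 * q * ℓ + (2 * q * c + 2 * q)) ∎)

  module Losers {n s D T A X P ts}
    (wT : Within 0 n T) (π : Path s T P ts X) (wX : Within 0 n X)
    (wA : Within 0 n A) (A↭P : inorder A ↭ P) (rootA : root A ≡ [ s ])
    (gain≤D : ∀ y → y ∈ P → y ≢ s → count (gained T A y) P ≤ D)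
    (q c : ℕ)
    (loss : ∀ x → x ∈ P → q * depth T x + 2 * depth T x ≤ 2 * q * (lostAncestors T A x + c))
    (σ : Bool) where

    open OneSide wT π wX wA A↭P rootA gain≤D σ

    losers : length P ≤ suc (2 * length nodes) → ∃ λ fl →
             (∀ {i c} → i < length nodes → fl (node# i) ≡ true → c ∈ᴵ C (node# i) → ¬ c ∈ᴵ B (node# (suc (i + D)))) ×
             length P ≤ 2 * q * count fl nodes + (2 * q * c + 2 * q + 3)
    losers m≤ with last-true (side σ s) P
    -- A majority side without nodes leaves a path of length at most 1, which the additive constant
    -- absorbs without any loser.
    ... | inj₁ none = (λ _ → false) , (λ _ ()) , ≤-trans m≤ (≤-trans
      (≤-reflexive (cong (λ v → suc (2 * v)) (trans (length-filterᵇ (side σ s) P) none)))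
      (≤-trans (s≤s z≤n) (≤-trans (m≤n+m 3 (2 * q * c + 2 * q)) (m≤n+m _ (2 * q * count (λ _ → false) nodes)))))
    ... | inj₂ (pre , z , post , P≡ , side-z , none) = fl , disjoint ,
      loss-arithmetic q a₀ b₀ c _ _ loss′ b≤ (≤-trans m≤ (≤-reflexive (trans (cong (λ v → suc (2 * v)) a≡) (cong suc (*-suc 2 a₀)))))
      where
      f : ℕ → Bool
      f = side σ s
      a₀ b₀ : ℕ
      a₀ = count f pre
      b₀ = count (not ∘ f) pre

      lost fl : ℕ → Bool
      lost y = not (y ∈ᵇ ancestors A z)
      -- `z` is not its own ancestor, so `lost z` holds; it is removed because a loser has to come
      -- strictly before `z`.
      fl y = lost y ∧ not (y ≡ᵇ z)

      z∈P : z ∈ P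
      z∈P = subst (z ∈_) (sym P≡) (∈-insert pre)

      z<s : z <[ σ ] s
      z<s = side⇒< σ side-z

      fl-lost : ∀ {y} → fl y ≡ true → y ∉ ancestors A z × y ≢ z
      fl-lost {y} e with y ∈ᵇ ancestors A z in y∈ᵇ | y ≡ᵇ z in y≡ᵇz
      ... | false | false = (λ y∈ → case trans (sym (∈⇒∈ᵇ y∈)) y∈ᵇ of λ ()) ,
                            (λ { refl → case trans (sym y≡ᵇz) (T⇒≡ (≡⇒≡ᵇ y y refl)) of λ () })

      before-z : ∀ {y} → y ∈ P → f y ≡ true → y ≢ z → Before P y z
      before-z {y} y∈P fy y≢z with ∈-++⁻ pre (subst (y ∈_) P≡ y∈P)
      ... | inj₁ y∈pre = subst (λ v → Before v y z) (sym P≡) (Before-++⁺ pre y∈pre (here refl))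
      ... | inj₂ (here y≡z) = contradiction y≡z y≢z
      ... | inj₂ (there y∈post) = case trans (sym fy) (count-zero f none y∈post) of λ ()

      disjoint : ∀ {i c} → i < length nodes → fl (node# i) ≡ true → c ∈ᴵ C (node# i) → ¬ c ∈ᴵ B (node# (suc (i + D)))
      disjoint {i} i<a e with x∉ , x≢z ← fl-lost e = lost-disjoint i<a z∈P z<s
        (proj₂ (toward (before-z (node∈P i) (<⇒side σ (node-side i<a)) x≢z)) σ (node-side i<a)) x∉

      a≡ : length nodes ≡ suc a₀
      a≡ = begin
        length nodes                              ≡⟨ length-filterᵇ f P ⟩
        count f P                                 ≡⟨ cong (count f) P≡ ⟩
        count f (pre ++ z ∷ post)                 ≡⟨ count-++ f pre _ ⟩
        a₀ + count f (z ∷ post)                   ≡⟨ cong (λ v → a₀ + (if v then suc (count f post) else count f post)) side-z ⟩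
        a₀ + suc (count f post)                   ≡⟨ cong (λ v → a₀ + suc v) none ⟩
        a₀ + 1                                    ≡⟨ +-comm a₀ 1 ⟩
        suc a₀                                    ∎
        where open ≡-Reasoning

      b≤ : b₀ ≤ 2 + a₀
      -- The side has `suc a₀` nodes in all, `z` being its last, and `m≤` leaves at most `2 + a₀`
      -- for the rest of the path, `s` included.
      b≤ = +-cancelˡ-≤ (suc a₀) _ _ (begin
        suc a₀ + b₀                                ≤⟨ +-monoʳ-≤ (suc a₀) b≤P ⟩
        suc a₀ + count (not ∘ f) P                ≡⟨ cong (_+ count (not ∘ f) P) (trans (sym a≡) (length-filterᵇ f P)) ⟩
        count f P + count (not ∘ f) P             ≡⟨ count-complement f P ⟩
        length P                                  ≤⟨ m≤ ⟩
        suc (2 * length nodes)                    ≡⟨ cong (λ v → suc (2 * v)) a≡ ⟩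
        suc (2 * suc a₀)                          ≡⟨ solve 1 (λ a → con 1 :+ con 2 :* (con 1 :+ a) := con 1 :+ a :+ (con 2 :+ a)) refl a₀ ⟩
        suc a₀ + (2 + a₀)                         ∎)
        where
        open ≤-Reasoning
        open +-*-Solver
        b≤P : b₀ ≤ count (not ∘ f) P
        b≤P = ≤-trans (m≤m+n b₀ _) (≤-reflexive (trans (sym (count-++ (not ∘ f) pre _)) (cong (count (not ∘ f)) (sym P≡))))

      anc≡ : ancestors T z ≡ pre
      anc≡ = Path-ancestors wT π pre P≡

      depth≡ : depth T z ≡ a₀ + b₀
      depth≡ = trans (cong length anc≡) (sym (count-complement f pre))

      pre≢z : ∀ {y} → y ∈ pre → y ≢ z
      pre≢z {y} y∈ = AllPairs-Before unique
        (subst (λ v → Before v y z) (sym P≡) (Before-++⁺ pre y∈ (here refl)))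

      lost⇒fl : ∀ {y} → y ∈ pre → lost y ≡ true → fl y ≡ true
      lost⇒fl {y} y∈ e with y ≡ᵇ z in y≡ᵇz
      ... | true  = contradiction (≡ᵇ⇒≡ y z (≡⇒T y≡ᵇz)) (pre≢z y∈)
      ... | false rewrite e = refl

      lost≤ : lostAncestors T A z ≤ count fl nodes + b₀
      lost≤ = begin
        count lost (ancestors T z)                ≡⟨ cong (count lost) anc≡ ⟩
        count lost pre                            ≤⟨ count-≤-filterᵇ f lost fl pre lost⇒fl ⟩
        count fl (filterᵇ f pre) + b₀              ≤⟨ +-monoˡ-≤ b₀ (m≤m+n _ (count fl (filterᵇ f (z ∷ post)))) ⟩
        count fl (filterᵇ f pre) + count fl (filterᵇ f (z ∷ post)) + b₀
          ≡⟨ cong (_+ b₀) (count-++ fl (filterᵇ f pre) _) ⟨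
        count fl (filterᵇ f pre ++ filterᵇ f (z ∷ post)) + b₀
          ≡⟨ cong (λ v → count fl v + b₀) (filter-++ _ pre (z ∷ post)) ⟨
        count fl (filterᵇ f (pre ++ z ∷ post)) + b₀ ≡⟨ cong (λ v → count fl (filterᵇ f v) + b₀) P≡ ⟨
        count fl nodes + b₀                        ∎
        where open ≤-Reasoning

      loss′ : q * (a₀ + b₀) + 2 * (a₀ + b₀) ≤ 2 * q * (count fl nodes + b₀ + c)
      loss′ = ≤-trans (≤-reflexive (cong (λ v → q * v + 2 * v) (sym depth≡)))
        (≤-trans (loss z z∈P) (*-monoʳ-≤ (2 * q) (+-monoˡ-≤ c lost≤)))

import Data.Nat
import Data.Nat.Properties as ℕ
open import Data.Nat.Coprimality using (1-coprimeTo) renaming (sym to coprime-sym)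
open import Data.Integer as ℤ using (+[1+_]; -[1+_])
import Data.Integer.Properties as ℤ
open import Data.Rational
  using (ℚ; mkℚ; _+_; _-_; -_; _*_; _≤_; _<_; ½; 0ℚ; 1ℚ; positive; nonNegative; ↧ₙ_; toℚᵘ; *<*)
open import Data.Rational.Properties
open import Data.Rational.Solver using (module +-*-Solver)
import Data.Rational.Unnormalised as ℚᵘ
import Data.Rational.Unnormalised.Properties as ℚᵘ
open import Data.List.Relation.Binary.Permutation.Propositional using (swap; refl; trans)
open SearchPaths

private variable
  x y z t : ℚ

-- Powers of rationals and Bernoulli's inequality

infixl 7 _·_
-- Repeated addition rather than a product with `ℕtoℚ n`, to suit the induction in `bernoulli`.
_·_ : ℕ → ℚ → ℚ
zero  · x = 0ℚ
suc n · x = x + n · x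

0≤* : 0ℚ ≤ x → 0ℚ ≤ y → 0ℚ ≤ x * y
0≤* {x} {y} 0≤x 0≤y = subst (_≤ x * y) (*-zeroʳ x) (*-monoˡ-≤-nonNeg x {{nonNegative 0≤x}} 0≤y)

0<* : 0ℚ < x → 0ℚ < y → 0ℚ < x * y
0<* {x} {y} 0<x 0<y = subst (_< x * y) (*-zeroʳ x) (*-monoʳ-<-pos x {{positive 0<x}} 0<y)

*-mono-≤ : 0ℚ ≤ x → x ≤ y → 0ℚ ≤ z → z ≤ t → x * z ≤ y * t
*-mono-≤ {x} {y} {z} 0≤x x≤y 0≤z z≤t = ≤-trans
  (*-monoʳ-≤-nonNeg z {{nonNegative 0≤z}} x≤y)
  (*-monoˡ-≤-nonNeg y {{nonNegative (≤-trans 0≤x x≤y)}} z≤t)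

0<^ : ∀ n → 0ℚ < x → 0ℚ < x ^ℚ n
0<^ zero    0<x = positive⁻¹ 1ℚ
0<^ (suc n) 0<x = 0<* 0<x (0<^ n 0<x)

^-monoˡ : ∀ n → 0ℚ < x → x ≤ y → x ^ℚ n ≤ y ^ℚ n
^-monoˡ zero    0<x x≤y = ≤-refl
^-monoˡ (suc n) 0<x x≤y = *-mono-≤ (<⇒≤ 0<x) x≤y (<⇒≤ (0<^ n 0<x)) (^-monoˡ n 0<x x≤y)

^-+ : ∀ x m n → x ^ℚ (m ℕ.+ n) ≡ x ^ℚ m * x ^ℚ n
^-+ x zero    n = sym (*-identityˡ _)
^-+ x (suc m) n = ≡.trans (cong (x *_) (^-+ x m n)) (sym (*-assoc x _ _))

^-* : ∀ x m n → x ^ℚ (n ℕ.* m) ≡ (x ^ℚ m) ^ℚ n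
^-* x m zero    = ≡.refl
^-* x m (suc n) = ≡.trans (^-+ x m (n ℕ.* m)) (cong (x ^ℚ m *_) (^-* x m n))

1≤^ : ∀ n → 1ℚ ≤ x → 1ℚ ≤ x ^ℚ n
1≤^ zero    1≤x = ≤-refl
1≤^ (suc n) 1≤x = *-mono-≤ {1ℚ} {_} {1ℚ} (nonNegative⁻¹ 1ℚ) 1≤x (nonNegative⁻¹ 1ℚ) (1≤^ n 1≤x)

^-monoʳ : ∀ {m n} → 1ℚ ≤ x → m ℕ.≤ n → x ^ℚ m ≤ x ^ℚ n
^-monoʳ {n = n} 1≤x z≤n = 1≤^ n 1≤x
^-monoʳ {m = suc m} 1≤x (s≤s m≤n) = *-mono-≤ (≤-trans (nonNegative⁻¹ 1ℚ) 1≤x) ≤-refl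
  (≤-trans (nonNegative⁻¹ 1ℚ) (1≤^ m 1≤x)) (^-monoʳ 1≤x m≤n)

·-+ : ∀ m n x → (m ℕ.+ n) · x ≡ m · x + n · x
·-+ zero    n x = sym (+-identityˡ _)
·-+ (suc m) n x = ≡.trans (cong (x +_) (·-+ m n x)) (sym (+-assoc x _ _))

2^·≡ : ∀ K x → ℕtoℚ 2 ^ℚ K * x ≡ (2 ℕ.^ K) · x
2^·≡ zero    x = ≡.trans (*-identityˡ x) (sym (+-identityʳ x))
2^·≡ (suc K) x = begin
  ℕtoℚ 2 * ℕtoℚ 2 ^ℚ K * x                   ≡⟨ *-assoc (ℕtoℚ 2) (ℕtoℚ 2 ^ℚ K) x ⟩
  (1ℚ + 1ℚ) * (ℕtoℚ 2 ^ℚ K * x)              ≡⟨ solve 1 (λ v → (con 1ℚ :+ con 1ℚ) :* v := v :+ v) ≡.refl (ℕtoℚ 2 ^ℚ K * x) ⟩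
  ℕtoℚ 2 ^ℚ K * x + ℕtoℚ 2 ^ℚ K * x          ≡⟨ cong₂ _+_ (2^·≡ K x) (2^·≡ K x) ⟩
  (2 ℕ.^ K) · x + (2 ℕ.^ K) · x              ≡⟨ ·-+ (2 ℕ.^ K) _ x ⟨
  (2 ℕ.^ K ℕ.+ 2 ℕ.^ K) · x                  ≡⟨ cong (λ v → (2 ℕ.^ K ℕ.+ v) · x) (ℕ.+-identityʳ _) ⟨
  (2 ℕ.^ suc K) · x                          ∎
  where
  open ≡.≡-Reasoning
  open +-*-Solver

-- Bernoulli's inequality (1 + δ/γ)^E ≥ 1 + Eδ/γ, multiplied by γ^(E+1).
bernoulli : ∀ {γ δ} E → 0ℚ < γ → 0ℚ ≤ δ → (γ + E · δ) * γ ^ℚ E ≤ γ * (γ + δ) ^ℚ E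
bernoulli {γ} zero 0<γ 0≤δ = ≤-reflexive (cong (_* 1ℚ) (+-identityʳ γ))
bernoulli {γ} {δ} (suc E) 0<γ 0≤δ = begin
  (γ + (δ + E · δ)) * (γ * γ ^ℚ E)
    ≡⟨ solve 4 (λ g d e p → (g :+ (d :+ e)) :* (g :* p) := g :* ((g :+ e) :* p) :+ d :* (g :* p)) ≡.refl γ δ (E · δ) (γ ^ℚ E) ⟩
  γ * ((γ + E · δ) * γ ^ℚ E) + δ * (γ * γ ^ℚ E)
    ≤⟨ +-mono-≤ (*-monoˡ-≤-nonNeg γ {{nonNegative (<⇒≤ 0<γ)}} (bernoulli E 0<γ 0≤δ))
                (*-monoˡ-≤-nonNeg δ {{nonNegative 0≤δ}} (*-monoˡ-≤-nonNeg γ {{nonNegative (<⇒≤ 0<γ)}}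
                  (^-monoˡ E 0<γ (p≤p+q γ 0≤δ)))) ⟩
  γ * (γ * (γ + δ) ^ℚ E) + δ * (γ * (γ + δ) ^ℚ E)
    ≡⟨ solve 3 (λ g d p → g :* (g :* p) :+ d :* (g :* p) := g :* ((g :+ d) :* p)) ≡.refl γ δ ((γ + δ) ^ℚ E) ⟩
  γ * ((γ + δ) * (γ + δ) ^ℚ E) ∎
  where
  open ≤-Reasoning
  open +-*-Solver
  p≤p+q : ∀ p {q} → 0ℚ ≤ q → p ≤ p + q
  p≤p+q p {q} 0≤q = subst (_≤ p + q) (+-identityʳ p) (+-monoʳ-≤ p 0≤q)

-- The power has exponent `2 ^ K` because Bernoulli's inequality gains only linearly in the
-- exponent, while a factor `2 ^ K` has to be absorbed. Multiplying by a power of `γ` replaces the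
-- division.
loser-bound : ∀ {β γ} K → 0ℚ < γ → 0ℚ ≤ x → x + γ ≤ β →
              ℕtoℚ 2 ^ℚ K * x * γ ^ℚ (2 ℕ.^ K) ≤ β * β ^ℚ (2 ℕ.^ K)
loser-bound {x} {β} {γ} K 0<γ 0≤x x+γ≤β = begin
  ℕtoℚ 2 ^ℚ K * x * γ ^ℚ E   ≡⟨ cong (_* γ ^ℚ E) (2^·≡ K x) ⟩
  E · x * γ ^ℚ E             ≤⟨ *-monoʳ-≤-nonNeg (γ ^ℚ E) {{nonNegative (<⇒≤ (0<^ E 0<γ))}}
                                  (subst (_≤ γ + E · x) (+-identityˡ (E · x)) (+-monoˡ-≤ (E · x) (<⇒≤ 0<γ))) ⟩
  (γ + E · x) * γ ^ℚ E       ≤⟨ bernoulli E 0<γ 0≤x ⟩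
  γ * (γ + x) ^ℚ E           ≤⟨ *-mono-≤ (<⇒≤ 0<γ) (≤-trans γ≤γ+x γ+x≤β)
                                  (<⇒≤ (0<^ E 0<γ+x)) (^-monoˡ E 0<γ+x γ+x≤β) ⟩
  β * β ^ℚ E                 ∎
  where
  open ≤-Reasoning
  E = 2 ℕ.^ K
  γ≤γ+x : γ ≤ γ + x
  γ≤γ+x = subst (_≤ γ + x) (+-identityʳ γ) (+-monoʳ-≤ γ 0≤x)
  0<γ+x : 0ℚ < γ + x
  0<γ+x = <-≤-trans 0<γ γ≤γ+x
  γ+x≤β : γ + x ≤ β
  γ+x≤β = subst (_≤ β) (+-comm x γ) x+γ≤β

-- Telescoping products

Π : ℕ → (ℕ → ℚ) → ℚ
Π zero    f = 1ℚ
Π (suc n) f = f 0 * Π n (λ i → f (suc i))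

0<Π : ∀ n {f} → (∀ i → 0ℚ < f i) → 0ℚ < Π n f
0<Π zero    0<f = positive⁻¹ 1ℚ
0<Π (suc n) 0<f = 0<* (0<f 0) (0<Π n (λ i → 0<f (suc i)))

0≤Π : ∀ n {f} → (∀ i → i ℕ.< n → 0ℚ ≤ f i) → 0ℚ ≤ Π n f
0≤Π zero    0≤f = nonNegative⁻¹ 1ℚ
0≤Π (suc n) 0≤f = 0≤* (0≤f 0 (s≤s z≤n)) (0≤Π n (λ i i<n → 0≤f (suc i) (s≤s i<n)))

Π-cong : ∀ n {f g} → (∀ i → f i ≡ g i) → Π n f ≡ Π n g
Π-cong zero    f≡g = ≡.refl
Π-cong (suc n) f≡g = cong₂ _*_ (f≡g 0) (Π-cong n (λ i → f≡g (suc i)))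

Π-* : ∀ n f g → Π n (λ i → f i * g i) ≡ Π n f * Π n g
Π-* zero    f g = ≡.refl
Π-* (suc n) f g = ≡.trans (cong (f 0 * g 0 *_) (Π-* n _ _))
  (solve 4 (λ a b c d → a :* b :* (c :* d) := a :* c :* (b :* d)) ≡.refl (f 0) (g 0) (Π n _) (Π n _))
  where open +-*-Solver

Π-mono : ∀ n {f g} → (∀ i → i ℕ.< n → 0ℚ ≤ f i) → (∀ i → i ℕ.< n → f i ≤ g i) → Π n f ≤ Π n g
Π-mono zero    0≤f f≤g = ≤-refl
Π-mono (suc n) 0≤f f≤g = *-mono-≤ (0≤f 0 (s≤s z≤n)) (f≤g 0 (s≤s z≤n))
  (0≤Π n (λ i i<n → 0≤f (suc i) (s≤s i<n)))
  (Π-mono n (λ i i<n → 0≤f (suc i) (s≤s i<n)) (λ i i<n → f≤g (suc i) (s≤s i<n)))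

Π-shift₁ : ∀ n v → Π n v * v n ≡ v 0 * Π n (λ i → v (suc i))
Π-shift₁ zero    v = ≡.trans (*-identityˡ (v 0)) (sym (*-identityʳ (v 0)))
Π-shift₁ (suc n) v = ≡.trans (*-assoc (v 0) _ _) (cong (v 0 *_) (≡.trans (Π-shift₁ n (λ i → v (suc i))) ≡.refl))

-- A shift by one trades the first factor, at most `W`, for the one past the end, at least `θ`; `k`
-- such shifts cost `k` factors on each side.
Π-shift : ∀ n k {θ W} v → 0ℚ < θ → (∀ i → θ ≤ v i) → (∀ i → v i ≤ W) →
          Π n v * θ ^ℚ k ≤ Π n (λ i → v (k ℕ.+ i)) * W ^ℚ k
Π-shift n zero    v 0<θ θ≤v v≤W = ≤-refl
Π-shift n (suc k) {θ} {W} v 0<θ θ≤v v≤W = begin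
  Π n v * (θ * θ ^ℚ k)                ≡⟨ *-assoc (Π n v) θ _ ⟨
  Π n v * θ * θ ^ℚ k                  ≤⟨ *-monoʳ-≤-nonNeg (θ ^ℚ k) {{nonNegative (<⇒≤ (0<^ k 0<θ))}} shift-by-one ⟩
  W * Π n v⁺ * θ ^ℚ k                 ≡⟨ *-assoc W _ _ ⟩
  W * (Π n v⁺ * θ ^ℚ k)               ≤⟨ *-monoˡ-≤-nonNeg W {{nonNegative 0≤W}}
                                           (Π-shift n k v⁺ 0<θ (λ i → θ≤v (suc i)) (λ i → v≤W (suc i))) ⟩
  W * (Π n (λ i → v (suc k ℕ.+ i)) * W ^ℚ k)
    ≡⟨ solve 3 (λ a b c → a :* (b :* c) := b :* (a :* c)) ≡.refl W (Π n (λ i → v (suc k ℕ.+ i))) (W ^ℚ k) ⟩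
  Π n (λ i → v (suc k ℕ.+ i)) * (W * W ^ℚ k) ∎
  where
  open ≤-Reasoning
  open +-*-Solver
  v⁺ : ℕ → ℚ
  v⁺ i = v (suc i)
  0<v : ∀ i → 0ℚ < v i
  0<v i = <-≤-trans 0<θ (θ≤v i)
  0≤W : 0ℚ ≤ W
  0≤W = <⇒≤ (<-≤-trans (0<v 0) (v≤W 0))
  shift-by-one : Π n v * θ ≤ W * Π n v⁺
  shift-by-one = begin
    Π n v * θ       ≤⟨ *-monoˡ-≤-nonNeg (Π n v) {{nonNegative (<⇒≤ (0<Π n 0<v))}} (θ≤v n) ⟩
    Π n v * v n     ≡⟨ Π-shift₁ n v ⟩
    v 0 * Π n v⁺    ≤⟨ *-monoʳ-≤-nonNeg (Π n v⁺) {{nonNegative (<⇒≤ (0<Π n (λ i → 0<v (suc i))))}} (v≤W 0) ⟩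
    W * Π n v⁺      ∎

boost : ℕ → Bool → ℚ
boost K fl = if fl then ℕtoℚ 2 ^ℚ K else 1ℚ

0≤boost : ∀ K fl → 0ℚ ≤ boost K fl
0≤boost K true  = <⇒≤ (0<^ K (positive⁻¹ (ℕtoℚ 2)))
0≤boost K false = nonNegative⁻¹ 1ℚ

-- Each loser i satisfies r i ≤ v i − v (k + i), hence gains the factor
-- 2^K at the price (v i / v (k + i))^(2^K), and this price telescopes.
telescope : ∀ n D k K {θ W} (v r : ℕ → ℚ) (fl : ℕ → Bool) →
  0ℚ < θ → (∀ i → θ ≤ v i) → (∀ i → v i ≤ W) →
  (∀ i → i ℕ.< n → 0ℚ ≤ r i) → (∀ i → i ℕ.< n → r i ≤ v i) → (∀ i → i ℕ.< n → v (k ℕ.+ i) ≤ v i) →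
  (∀ i → i ℕ.< n → fl i ≡ true → r i + v (k ℕ.+ i) ≤ v i) →
  Π n (λ i → boost K (fl i) * r i) * θ ^ℚ (D ℕ.+ k ℕ.* 2 ℕ.^ K)
    ≤ Π n (λ i → v (D ℕ.+ i)) * W ^ℚ (D ℕ.+ k ℕ.* 2 ℕ.^ K)
telescope n D k K {θ} {W} v r fl 0<θ θ≤v v≤W 0≤r r≤v decr loser =
  -- `Q` collects the denominators `v (k + i) ^ E`. It is multiplied in to allow the pointwise bound
  -- and reappears on the right once the powers are shifted by `k`.
  *-cancelʳ-≤-pos Q {{positive 0<Q}} (begin
    X * θ ^ℚ (D ℕ.+ k ℕ.* E) * Q    ≡⟨ cong (λ u → X * u * Q) (split θ) ⟩
    X * (θ ^ℚ D * (θ ^ℚ E) ^ℚ k) * Q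
      ≡⟨ solve 4 (λ x a b q → x :* (a :* b) :* q := (x :* q) :* (a :* b)) ≡.refl X (θ ^ℚ D) _ Q ⟩
    (X * Q) * (θ ^ℚ D * (θ ^ℚ E) ^ℚ k)
      ≤⟨ *-monoʳ-≤-nonNeg _ {{nonNegative (0≤* (<⇒≤ (0<^ D 0<θ)) (<⇒≤ (0<^ k (0<^ E 0<θ))))}} pointwise ⟩
    (V * VE) * (θ ^ℚ D * (θ ^ℚ E) ^ℚ k)
      ≡⟨ solve 4 (λ x y a b → (x :* y) :* (a :* b) := (x :* a) :* (y :* b)) ≡.refl V VE (θ ^ℚ D) _ ⟩
    (V * θ ^ℚ D) * (VE * (θ ^ℚ E) ^ℚ k)
      -- Two shifts: by `D` for the plain factors, which compares the new weights with the old
      -- weights of the same nodes, and by `k` for the `E`-th powers, which is the telescoping of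
      -- the price.
      ≤⟨ *-mono-≤ (0≤* (<⇒≤ (0<Π n 0<v)) (<⇒≤ (0<^ D 0<θ))) (Π-shift n D v 0<θ θ≤v v≤W)
                  (0≤* (<⇒≤ (0<Π n (λ i → 0<^ E (0<v i)))) (<⇒≤ (0<^ k (0<^ E 0<θ))))
                  (Π-shift n k _ (0<^ E 0<θ) (λ i → ^-monoˡ E 0<θ (θ≤v i)) (λ i → ^-monoˡ E (0<v i) (v≤W i))) ⟩
    (U * W ^ℚ D) * (Q * (W ^ℚ E) ^ℚ k)
      ≡⟨ solve 4 (λ x a q b → (x :* a) :* (q :* b) := x :* (a :* b) :* q) ≡.refl U (W ^ℚ D) Q _ ⟩
    U * (W ^ℚ D * (W ^ℚ E) ^ℚ k) * Q  ≡⟨ cong (λ u → U * u * Q) (split W) ⟨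
    U * W ^ℚ (D ℕ.+ k ℕ.* E) * Q    ∎)
  where
  open ≤-Reasoning
  open +-*-Solver
  E = 2 ℕ.^ K
  X = Π n (λ i → boost K (fl i) * r i)
  Q = Π n (λ i → v (k ℕ.+ i) ^ℚ E)
  V = Π n v
  VE = Π n (λ i → v i ^ℚ E)
  U = Π n (λ i → v (D ℕ.+ i))
  0<v : ∀ i → 0ℚ < v i
  0<v i = <-≤-trans 0<θ (θ≤v i)
  0<Q : 0ℚ < Q
  0<Q = 0<Π n (λ i → 0<^ E (0<v (k ℕ.+ i)))
  split : ∀ x → x ^ℚ (D ℕ.+ k ℕ.* E) ≡ x ^ℚ D * (x ^ℚ E) ^ℚ k
  split x = ≡.trans (^-+ x D (k ℕ.* E)) (cong (x ^ℚ D *_) (^-* x E k))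

  bound : ∀ i → i ℕ.< n → boost K (fl i) * r i * v (k ℕ.+ i) ^ℚ E ≤ v i * v i ^ℚ E
  bound i i<n with fl i in e
  ... | true  = loser-bound K (0<v (k ℕ.+ i)) (0≤r i i<n) (loser i i<n e)
  ... | false = *-mono-≤ (0≤* (nonNegative⁻¹ 1ℚ) (0≤r i i<n))
    (subst (_≤ v i) (sym (*-identityˡ _)) (r≤v i i<n))
    (<⇒≤ (0<^ E (0<v (k ℕ.+ i)))) (^-monoˡ E (0<v (k ℕ.+ i)) (decr i i<n))

  pointwise : X * Q ≤ V * VE
  pointwise = begin
    X * Q ≡⟨ Π-* n _ _ ⟨
    _     ≤⟨ Π-mono n (λ i i<n → 0≤* (0≤* (0≤boost K (fl i)) (0≤r i i<n)) (<⇒≤ (0<^ E (0<v (k ℕ.+ i))))) bound ⟩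
    _     ≡⟨ Π-* n _ _ ⟩
    V * VE ∎

-- The loss hypothesis over the natural numbers

ℕtoℚ≡mkℚ : ∀ n → ℕtoℚ n ≡ mkℚ (ℤ.+ n) 0 (coprime-sym (1-coprimeTo n))
ℕtoℚ≡mkℚ n = normalize-coprime (coprime-sym (1-coprimeTo n))

ℕtoℚ-+ : ∀ m n → ℕtoℚ (m ℕ.+ n) ≡ ℕtoℚ m + ℕtoℚ n
ℕtoℚ-+ m n rewrite ℕtoℚ≡mkℚ m | ℕtoℚ≡mkℚ n | ℤ.*-identityʳ (ℤ.+ m) | ℤ.*-identityʳ (ℤ.+ n) = ≡.refl

ℕtoℚ-* : ∀ m n → ℕtoℚ (m ℕ.* n) ≡ ℕtoℚ m * ℕtoℚ n
ℕtoℚ-* m n rewrite ℕtoℚ≡mkℚ m | ℕtoℚ≡mkℚ n | sym (ℤ.pos-* m n) = ≡.refl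

ℕtoℚ-cancel-≤ : ∀ {m n} → ℕtoℚ m ≤ ℕtoℚ n → m ℕ.≤ n
ℕtoℚ-cancel-≤ {m} {n} m≤n rewrite ℕtoℚ≡mkℚ m | ℕtoℚ≡mkℚ n =
  ℤ.drop‿+≤+ (≡.subst₂ ℤ._≤_ (ℤ.*-identityʳ (ℤ.+ m)) (ℤ.*-identityʳ (ℤ.+ n)) (drop-*≤* m≤n))

0≤ℕtoℚ : ∀ n → 0ℚ ≤ ℕtoℚ n
0≤ℕtoℚ n rewrite ℕtoℚ≡mkℚ n = nonNegative⁻¹ _

-- The product is the numerator of `ε`, a positive integer.
1≤ε*↧ε : ∀ ε → 0ℚ < ε → 1ℚ ≤ ε * ℕtoℚ (↧ₙ ε)
1≤ε*↧ε (mkℚ (ℤ.+ 0) d-1 _) (*<* (ℤ.+<+ ()))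
1≤ε*↧ε ε@(mkℚ +[1+ p ] d-1 _) _ rewrite ℕtoℚ≡mkℚ (suc d-1) =
  toℚᵘ-cancel-≤ (ℚᵘ.≤-trans (ℚᵘ.*≤* (ℤ.+≤+ le)) (ℚᵘ.≤-reflexive (ℚᵘ.≃-sym (toℚᵘ-homo-* ε (mkℚ (ℤ.+ suc d-1) 0 (coprime-sym (1-coprimeTo (suc d-1))))))))
  where
  le : 1 ℕ.* (suc d-1 ℕ.* 1) ℕ.≤ suc p ℕ.* suc d-1 ℕ.* 1
  le = ≡.subst₂ ℕ._≤_ (≡.trans (sym (ℕ.*-identityʳ (suc d-1))) (sym (ℕ.*-identityˡ (suc d-1 ℕ.* 1)))) (sym (ℕ.*-identityʳ _)) (ℕ.m≤n*m (suc d-1) (suc p))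
1≤ε*↧ε (mkℚ -[1+ p ] d-1 _) (*<* ())

-- Multiplication by `2q`, with `q` the denominator of `ε`, turns `(½ + ε) d` into
-- `q d + 2 (ε q) d`, and `ε q` is at least 1.
clear-denominators : ∀ ε c d ℓ → 0ℚ < ε → ((½ + ε) * ℕtoℚ d) - ℕtoℚ c ≤ ℕtoℚ ℓ →
                     ↧ₙ ε ℕ.* d ℕ.+ 2 ℕ.* d ℕ.≤ 2 ℕ.* ↧ₙ ε ℕ.* (ℓ ℕ.+ c)
clear-denominators ε c d ℓ 0<ε h = ℕtoℚ-cancel-≤ (begin
  ℕtoℚ (q ℕ.* d ℕ.+ 2 ℕ.* d)           ≡⟨ ≡.trans (ℕtoℚ-+ (q ℕ.* d) (2 ℕ.* d)) (cong₂ _+_ (ℕtoℚ-* q d) (ℕtoℚ-* 2 d)) ⟩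
  Q * ℕtoℚ d + ℕtoℚ 2 * ℕtoℚ d         ≡⟨ cong (λ v → Q * ℕtoℚ d + ℕtoℚ 2 * v) (*-identityˡ (ℕtoℚ d)) ⟨
  Q * ℕtoℚ d + ℕtoℚ 2 * (1ℚ * ℕtoℚ d)
    ≤⟨ +-monoʳ-≤ (Q * ℕtoℚ d) (*-monoˡ-≤-nonNeg (ℕtoℚ 2) (*-monoʳ-≤-nonNeg (ℕtoℚ d) {{nonNegative (0≤ℕtoℚ d)}} (1≤ε*↧ε ε 0<ε))) ⟩
  Q * ℕtoℚ d + ℕtoℚ 2 * (ε * Q * ℕtoℚ d)
    ≡⟨ solve 4 (λ Q d e c → Q :* d :+ con (ℕtoℚ 2) :* (e :* Q :* d)
         := con (ℕtoℚ 2) :* Q :* ((con ½ :+ e) :* d :- c :+ c)) ≡.refl Q (ℕtoℚ d) ε (ℕtoℚ c) ⟩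
  ℕtoℚ 2 * Q * (((½ + ε) * ℕtoℚ d) - ℕtoℚ c + ℕtoℚ c)
    ≤⟨ *-monoˡ-≤-nonNeg (ℕtoℚ 2 * Q) {{nonNegative (0≤* (0≤ℕtoℚ 2) (0≤ℕtoℚ q))}} (+-monoˡ-≤ (ℕtoℚ c) h) ⟩
  ℕtoℚ 2 * Q * (ℕtoℚ ℓ + ℕtoℚ c)       ≡⟨ cong₂ _*_ (ℕtoℚ-* 2 q) (ℕtoℚ-+ ℓ c) ⟨
  ℕtoℚ (2 ℕ.* q) * ℕtoℚ (ℓ ℕ.+ c)      ≡⟨ ℕtoℚ-* (2 ℕ.* q) (ℓ ℕ.+ c) ⟨
  ℕtoℚ (2 ℕ.* q ℕ.* (ℓ ℕ.+ c))         ∎)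
  where
  open ≤-Reasoning
  open +-*-Solver
  q = ↧ₙ ε
  Q = ℕtoℚ q

-- Products over path nodes

∏ : {I : Set} → (I → ℚ) → List I → ℚ
∏ h []       = 1ℚ
∏ h (x ∷ xs) = h x * ∏ h xs

module _ {I : Set} (h : I → ℚ) where

  ∏-++ : ∀ xs ys → ∏ h (xs ++ ys) ≡ ∏ h xs * ∏ h ys
  ∏-++ []       ys = sym (*-identityˡ _)
  ∏-++ (x ∷ xs) ys = ≡.trans (cong (h x *_) (∏-++ xs ys)) (sym (*-assoc (h x) (∏ h xs) (∏ h ys)))

  ∏-↭ : ∀ {xs ys} → xs ↭ ys → ∏ h xs ≡ ∏ h ys
  ∏-↭ refl          = ≡.refl
  ∏-↭ (prep x p)    = cong (h x *_) (∏-↭ p)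
  ∏-↭ (swap {xs} {ys} x y p)  = ≡.trans (cong (λ v → h x * (h y * v)) (∏-↭ p))
    (solve 3 (λ a b c → a :* (b :* c) := b :* (a :* c)) ≡.refl (h x) (h y) (∏ h ys))
    where open +-*-Solver
  ∏-↭ (trans p q)   = ≡.trans (∏-↭ p) (∏-↭ q)

  ∏-cong : ∀ {g} xs → (∀ {x} → x ∈ xs → h x ≡ g x) → ∏ h xs ≡ ∏ g xs
  ∏-cong []       e = ≡.refl
  ∏-cong (x ∷ xs) e = cong₂ _*_ (e (here ≡.refl)) (∏-cong xs (e ∘ there))

  0≤∏ : ∀ xs → (∀ {x} → x ∈ xs → 0ℚ ≤ h x) → 0ℚ ≤ ∏ h xs
  0≤∏ []       0≤h = nonNegative⁻¹ 1ℚ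
  0≤∏ (x ∷ xs) 0≤h = 0≤* (0≤h (here ≡.refl)) (0≤∏ xs (0≤h ∘ there))

-- Passes from nodes to positions, where a shift along the side makes sense.
∏-nth : ∀ h d xs → ∏ h xs ≡ Π (length xs) (h ∘ nth d xs)
∏-nth h d []       = ≡.refl
∏-nth h d (x ∷ xs) = cong (h x *_) (∏-nth h d xs)

∏-boost : ∀ K fl h xs → ∏ (λ y → boost K (fl y) * h y) xs ≡ (ℕtoℚ 2 ^ℚ K) ^ℚ count fl xs * ∏ h xs
∏-boost K fl h [] = ≡.refl
∏-boost K fl h (x ∷ xs) with fl x
... | true  = ≡.trans (cong (G * h x *_) (∏-boost K fl h xs))
  (solve 4 (λ a b c d → a :* b :* (c :* d) := a :* c :* (b :* d)) ≡.refl G (h x) (G ^ℚ count fl xs) (∏ h xs))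
  where
  open +-*-Solver
  G = ℕtoℚ 2 ^ℚ K
... | false = ≡.trans (cong (1ℚ * h x *_) (∏-boost K fl h xs))
  (solve 3 (λ b c d → con 1ℚ :* b :* (c :* d) := c :* (b :* d)) ≡.refl (h x) (G ^ℚ count fl xs) (∏ h xs))
  where
  open +-*-Solver
  G = ℕtoℚ 2 ^ℚ K

∏-sides : ∀ {n s T P ts X} h → Within 0 n T → Path s T P ts X → ∀ σ →
          ∏ h P ≡ ∏ h (filterᵇ (side σ s) P) * ∏ h (filterᵇ (side (not σ) s) P) * h s
∏-sides {s = s} h wT π true = go (Path-EndsIn π) (Path-Toward wT π)
  where
  open +-*-Solver
  L R : List ℕ → ℚ
  L P = ∏ h (filterᵇ (side true s) P)
  R P = ∏ h (filterᵇ (side false s) P)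
  go : ∀ {P} → EndsIn s P → AllPairs (λ p q → p ≢ s × Toward s p q) P → ∏ h P ≡ L P * R P * h s
  go [-] _ rewrite side-irrefl {s} true = solve 1 (λ a → a :* con 1ℚ := con 1ℚ :* con 1ℚ :* a) ≡.refl (h s)
  go (_∷_ {P} x E) (rx ∷ r) with <[]-cmp true x s
  ... | tri< x<s _ _ rewrite <⇒side true x<s | ≯⇒side false (ℕ.<-asym x<s) = ≡.trans (cong (h x *_) (go E r))
    (solve 4 (λ a b c d → a :* (b :* c :* d) := a :* b :* c :* d) ≡.refl (h x) (L P) (R P) (h s))
  ... | tri≈ _ x≡s _ = contradiction x≡s (proj₁ (All.lookup rx (EndsIn-∈ E)))
  ... | tri> _ _ s<x rewrite ≯⇒side true (ℕ.<-asym s<x) | <⇒side false s<x = ≡.trans (cong (h x *_) (go E r))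
    (solve 4 (λ a b c d → a :* (b :* c :* d) := b :* (a :* c) :* d) ≡.refl (h x) (L P) (R P) (h s))
∏-sides {s = s} {P = P} h wT π false = ≡.trans (∏-sides h wT π true) (cong (_* h s)
  (*-comm (∏ h (filterᵇ (side true s) P)) (∏ h (filterᵇ (side false s) P))))

-- Filling uses one tree more than there are keys, whatever the shape. So the after-tree uses up
-- exactly the trees that the original path does.
fill-rest : ∀ A ts → proj₂ (fill A ts) ≡ drop (suc (length (inorder A))) ts
fill-rest leaf []       = ≡.refl
fill-rest leaf (t ∷ ts) = ≡.refl
fill-rest (node l k r) ts = begin
  proj₂ (fill r (proj₂ (fill l ts)))                   ≡⟨ fill-rest r _ ⟩
  drop (suc #r) (proj₂ (fill l ts))                    ≡⟨ cong (drop (suc #r)) (fill-rest l ts) ⟩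
  drop (suc #r) (drop (suc #l) ts)                     ≡⟨ drop-drop (suc #l) (suc #r) ts ⟩
  drop (suc #l ℕ.+ suc #r) ts                          ≡⟨ cong (λ v → drop (suc v) ts) (length-++ (inorder l)) ⟨
  drop (suc (length (inorder l ++ k ∷ inorder r))) ts  ∎
  where
  open ≡.≡-Reasoning
  #l = length (inorder l)
  #r = length (inorder r)

-- Weights of key intervals and the factored potential

module Weights (w : ℕ → ℚ) (n : ℕ) (pos : PosWeights n w) where

  -- Prefix sums make the weight of an interval a difference, and additivity over adjacent intervals
  -- a ring identity.
  S : ℕ → ℚ
  S zero    = 0ℚ
  S (suc k) = S k + w k

  R : ℕ × ℕ → ℚ
  R I = S (proj₂ I) - S (proj₁ I)

  weightOf-Run : ∀ {a b xs} → Run a b xs → weightOf w xs ≡ R (a , b)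
  weightOf-Run {a} [] = sym (+-inverseʳ (S a))
  weightOf-Run {a} {b} ([-]∷ ρ) = ≡.trans (cong (w a +_) (weightOf-Run ρ))
    (solve 3 (λ x y z → x :+ (y :- (z :+ x)) := y :- z) ≡.refl (w a) (S b) (S a))
    where open +-*-Solver

  S-mono : ∀ {a b} → a ℕ.≤ b → b ℕ.≤ n → S a ≤ S b
  S-mono {b = zero}  z≤n _ = ≤-refl
  S-mono {a} {suc b} a≤1+b b<n with ℕ.m≤n⇒m<n∨m≡n a≤1+b
  ... | inj₂ ≡.refl = ≤-refl
  ... | inj₁ (s≤s a≤b) = ≤-trans (S-mono a≤b (ℕ.<⇒≤ b<n))
    (subst (_≤ S b + w b) (+-identityʳ (S b)) (+-monoʳ-≤ (S b) (<⇒≤ (pos b b<n))))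

  R-mono : ∀ {a b c d} → c ℕ.≤ a → a ℕ.≤ n → b ℕ.≤ d → d ℕ.≤ n → R (a , b) ≤ R (c , d)
  R-mono c≤a a≤n b≤d d≤n = +-mono-≤ (S-mono b≤d d≤n) (neg-antimono-≤ (S-mono c≤a a≤n))

  0≤R : ∀ {a b} → a ℕ.≤ b → b ℕ.≤ n → 0ℚ ≤ R (a , b)
  0≤R {a} {b} a≤b b≤n = subst (_≤ R (a , b)) (+-inverseʳ (S a)) (+-monoˡ-≤ (- S a) (S-mono a≤b b≤n))

  R-+ : ∀ a b c → R (a , b) + R (b , c) ≡ R (a , c)
  R-+ a b c = solve 3 (λ x y z → (y :- x) :+ (z :- y) := z :- x) ≡.refl (S a) (S b) (S c)
    where open +-*-Solver

  -- The two extreme keys are tested for membership; the witness `p` excludes the empty interval,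
  -- which has no such keys.
  ⊆⇒endpoints : ∀ {a b c d p} → p ∈ᴵ (a , b) → (∀ {x} → x ∈ᴵ (a , b) → x ∈ᴵ (c , d)) → c ℕ.≤ a × b ℕ.≤ d
  ⊆⇒endpoints {b = suc b} (a≤p , s≤s p≤b) sub =
    proj₁ (sub (ℕ.≤-refl , s≤s (ℕ.≤-trans a≤p p≤b))) , proj₂ (sub (ℕ.≤-trans a≤p p≤b , ℕ.≤-refl))

  R-⊆ : ∀ {I J p} → p ∈ᴵ I → (∀ {x} → x ∈ᴵ I → x ∈ᴵ J) → proj₂ J ℕ.≤ n → R I ≤ R J
  R-⊆ p∈I sub J≤n with c≤a , b≤d ← ⊆⇒endpoints p∈I sub =
    R-mono c≤a (ℕ.≤-trans (ℕ.≤-trans (proj₁ p∈I) (ℕ.<⇒≤ (proj₂ p∈I))) (ℕ.≤-trans b≤d J≤n)) b≤d J≤n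

  R-disjoint : ∀ {I J L p q} → p ∈ᴵ I → q ∈ᴵ J → (∀ {x} → x ∈ᴵ I → x ∈ᴵ L) → (∀ {x} → x ∈ᴵ J → x ∈ᴵ L) →
               (∀ {x} → x ∈ᴵ I → ¬ x ∈ᴵ J) → proj₂ L ℕ.≤ n → R I + R J ≤ R L
  R-disjoint {a , b} {c , d} {e , f} p∈I q∈J I⊆L J⊆L disj L≤n
    with e≤a , b≤f ← ⊆⇒endpoints p∈I I⊆L | e≤c , d≤f ← ⊆⇒endpoints q∈J J⊆L
    with b ℕ.≤? c | d ℕ.≤? a
  ... | yes b≤c | _ = begin
    R (a , b) + R (c , d) ≤⟨ +-monoˡ-≤ (R (c , d)) (R-mono ℕ.≤-refl a≤n b≤c c≤n) ⟩
    R (a , c) + R (c , d) ≡⟨ R-+ a c d ⟩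
    R (a , d)             ≤⟨ R-mono e≤a a≤n d≤f L≤n ⟩
    R (e , f)             ∎
    where
    open ≤-Reasoning
    c≤n = ℕ.≤-trans (ℕ.≤-trans (proj₁ q∈J) (ℕ.<⇒≤ (proj₂ q∈J))) (ℕ.≤-trans d≤f L≤n)
    a≤n = ℕ.≤-trans (ℕ.≤-trans (proj₁ p∈I) (ℕ.<⇒≤ (proj₂ p∈I))) (ℕ.≤-trans b≤f L≤n)
  ... | no _ | yes d≤a = begin
    R (a , b) + R (c , d) ≤⟨ +-monoʳ-≤ (R (a , b)) (R-mono ℕ.≤-refl c≤n d≤a a≤n) ⟩
    R (a , b) + R (c , a) ≡⟨ +-comm (R (a , b)) (R (c , a)) ⟩
    R (c , a) + R (a , b) ≡⟨ R-+ c a b ⟩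
    R (c , b)             ≤⟨ R-mono e≤c c≤n b≤f L≤n ⟩
    R (e , f)             ∎
    where
    open ≤-Reasoning
    c≤n = ℕ.≤-trans (ℕ.≤-trans (proj₁ q∈J) (ℕ.<⇒≤ (proj₂ q∈J))) (ℕ.≤-trans d≤f L≤n)
    a≤n = ℕ.≤-trans (ℕ.≤-trans (proj₁ p∈I) (ℕ.<⇒≤ (proj₂ p∈I))) (ℕ.≤-trans b≤f L≤n)
  -- Neither interval ends before the other starts, so the larger of the two left endpoints lies in
  -- both.
  ... | no b≰c | no d≰a with ℕ.≤-total a c
  ...   | inj₁ a≤c = contradiction (ℕ.≤-refl , ℕ.≤-<-trans (proj₁ q∈J) (proj₂ q∈J)) (disj (a≤c , ℕ.≰⇒> b≰c))
  ...   | inj₂ c≤a = contradiction (c≤a , ℕ.≰⇒> d≰a) (disj (ℕ.≤-refl , ℕ.≤-<-trans (proj₁ p∈I) (proj₂ p∈I)))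

  0≤expPotential : ∀ {lo hi} T → Run lo hi (inorder T) → hi ℕ.≤ n → 0ℚ ≤ expPotential w T
  0≤expPotential leaf _ _ = nonNegative⁻¹ 1ℚ
  0≤expPotential (node l k r) ρ hi≤n with ρl , ρr ← Run-++⁻ (inorder l) ρ =
    0≤* (subst (0ℚ ≤_) (sym (weightOf-Run ρ)) (0≤R (Run-≤ ρ) hi≤n))
        (0≤* (0≤expPotential l ρl (ℕ.≤-trans (ℕ.<⇒≤ (Run-≤ ρr)) hi≤n)) (0≤expPotential r ρr hi≤n))

  0≤pendants : ∀ {lo hi s T P ts X t} → Run lo hi (inorder T) → hi ℕ.≤ n → Path s T P ts X →
               t ∈ ts → 0ℚ ≤ expPotential w t
  0≤pendants ρ hi≤n π = All.lookup (go ρ hi≤n π)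
    where
    go : ∀ {lo hi s T P ts X} → Run lo hi (inorder T) → hi ℕ.≤ n → Path s T P ts X → All (λ t → 0ℚ ≤ expPotential w t) ts
    go ρ hi≤n (stop {l} {r}) with ρl , ρr ← Run-++⁻ (inorder l) ρ =
      0≤expPotential l ρl (ℕ.≤-trans (ℕ.<⇒≤ (Run-≤ ρr)) hi≤n) ∷ 0≤expPotential r ρr hi≤n ∷ []
    go ρ hi≤n (left {l = l} {r = r} _ π) with ρl , ρr ← Run-++⁻ (inorder l) ρ =
      All.++⁺ (go ρl (ℕ.≤-trans (ℕ.<⇒≤ (Run-≤ ρr)) hi≤n) π) (0≤expPotential r ρr hi≤n ∷ [])
    go ρ hi≤n (right {l = l} _ π) with ρl , ρr ← Run-++⁻ (inorder l) ρ =
      0≤expPotential l ρl (ℕ.≤-trans (ℕ.<⇒≤ (Run-≤ ρr)) hi≤n) ∷ go ρr hi≤n π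

  expPotential-fill : ∀ {lo hi} A ts → Run lo hi (inorder (proj₁ (fill A ts))) →
    expPotential w (proj₁ (fill A ts)) * ∏ (expPotential w) (proj₂ (fill A ts))
      ≡ ∏ (R ∘ span A lo hi) (inorder A) * ∏ (expPotential w) ts
  expPotential-fill leaf []       ρ = ≡.refl
  expPotential-fill leaf (t ∷ ts) ρ = sym (*-identityˡ _)
  expPotential-fill {lo} {hi} (node l k r) ts ρ with ρl , ρr ← Run-++⁻ (inorder (proj₁ (fill l ts))) ρ = begin
    weightOf w (inorder l′ ++ k ∷ inorder r′) * (expPotential w l′ * expPotential w r′) * p₂
      ≡⟨ cong (λ v → v * (expPotential w l′ * expPotential w r′) * p₂) (weightOf-Run ρ) ⟩
    R (lo , hi) * (expPotential w l′ * expPotential w r′) * p₂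
      ≡⟨ solve 4 (λ a b c d → a :* (b :* c) :* d := a :* b :* (c :* d)) ≡.refl (R (lo , hi)) (expPotential w l′) (expPotential w r′) p₂ ⟩
    R (lo , hi) * expPotential w l′ * (expPotential w r′ * p₂)
      ≡⟨ cong (R (lo , hi) * expPotential w l′ *_) (expPotential-fill r ts₁ ρr) ⟩
    R (lo , hi) * expPotential w l′ * (Ar * p₁)
      ≡⟨ solve 4 (λ a b c d → a :* b :* (c :* d) := a :* c :* (b :* d)) ≡.refl (R (lo , hi)) (expPotential w l′) Ar p₁ ⟩
    R (lo , hi) * Ar * (expPotential w l′ * p₁)
      ≡⟨ cong (R (lo , hi) * Ar *_) (expPotential-fill l ts ρl) ⟩
    R (lo , hi) * Ar * (Al * p₀)
      ≡⟨ solve 4 (λ a b c d → a :* b :* (c :* d) := c :* (a :* b) :* d) ≡.refl (R (lo , hi)) Ar Al p₀ ⟩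
    Al * (R (lo , hi) * Ar) * p₀
      ≡⟨ cong (_* p₀) (cong₂ _*_ Al≡ (cong₂ _*_ root≡ Ar≡)) ⟩
    ∏ h (inorder l) * ∏ h (k ∷ inorder r) * p₀
      ≡⟨ cong (_* p₀) (∏-++ h (inorder l) (k ∷ inorder r)) ⟨
    ∏ h (inorder l ++ k ∷ inorder r) * p₀ ∎
    where
    open ≡.≡-Reasoning
    open +-*-Solver
    h = R ∘ span (node l k r) lo hi
    l′ = proj₁ (fill l ts)
    ts₁ = proj₂ (fill l ts)
    r′ = proj₁ (fill r ts₁)
    ts₂ = proj₂ (fill r ts₁)
    p₀ = ∏ (expPotential w) ts
    p₁ = ∏ (expPotential w) ts₁
    p₂ = ∏ (expPotential w) ts₂
    Al = ∏ (R ∘ span l lo k) (inorder l)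
    Ar = ∏ (R ∘ span r (suc k) hi) (inorder r)
    wl = Run-fill⇒Within l ts ρl
    wr = Run-fill⇒Within r ts₁ ρr
    Al≡ : Al ≡ ∏ h (inorder l)
    Al≡ = ∏-cong (R ∘ span l lo k) {h} (inorder l) λ {y} y∈l →
      cong R (sym (span-left {y} {k} {l} {r} {lo} {hi} (proj₂ (Within-∈ wl y∈l))))
    Ar≡ : Ar ≡ ∏ h (inorder r)
    Ar≡ = ∏-cong (R ∘ span r (suc k) hi) {h} (inorder r) λ {y} y∈r →
      cong R (sym (span-right {k} {y} {l} {r} {lo} {hi} (proj₁ (Within-∈ wr y∈r))))
    root≡ : R (lo , hi) ≡ h k
    root≡ = cong R (sym (span-root {l} {k} {r} {lo} {hi}))

-- The bound for one side

pad : {I : Set} → I → ℕ → (ℕ → I) → ℕ → I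
pad W zero    u i       = u i
pad W (suc D) u zero    = W
pad W (suc D) u (suc i) = pad W D u i

pad-+ : {I : Set} (W : I) (D : ℕ) (u : ℕ → I) (i : ℕ) → pad W D u (D ℕ.+ i) ≡ u i
pad-+ W zero    u i = ≡.refl
pad-+ W (suc D) u i = pad-+ W D u i

pad-cases : {I : Set} (W : I) (D : ℕ) (u : ℕ → I) (i : ℕ) →
            pad W D u i ≡ W ⊎ ∃ λ j → i ≡ D ℕ.+ j × pad W D u i ≡ u j
pad-cases W zero    u i    = inj₂ (i , ≡.refl , ≡.refl)
pad-cases W (suc D) u zero = inj₁ ≡.refl
pad-cases W (suc D) u (suc i) with pad-cases W D u i
... | inj₁ e             = inj₁ e
... | inj₂ (j , ≡.refl , e) = inj₂ (j , ≡.refl , e)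

-- `D` for the shift that aligns the plain factors, and `2D + 1` shifts of `2 ^ K`-th powers for the
-- price of the losers.
exponent : ℕ → ℕ → ℕ
exponent D K = D ℕ.+ (D ℕ.+ suc D) ℕ.* 2 ℕ.^ K

module SideBound {n s D T A X P ts}
  (wT : Within 0 n T) (π : Path s T P ts X) (wX : Within 0 n X)
  (wA : Within 0 n A) (A↭P : inorder A ↭ P) (rootA : root A ≡ [ s ])
  (gain≤D : ∀ y → y ∈ P → y ≢ s → count (gained T A y) P ℕ.≤ D)
  (w : ℕ → ℚ) (pos : PosWeights n w) (s<n : s ℕ.< n)
  (σ : Bool) where

  open OneSide wT π wX wA A↭P rootA gain≤D σ
  open Weights w n pos

  B-bound : ∀ {p} → p ∈ P → proj₂ (B p) ℕ.≤ n
  B-bound p∈P = proj₂ (Spans-bounds wX (spansB p∈P))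

  C-bound : ∀ {p} → p ∈ P → proj₂ (C p) ℕ.≤ n
  C-bound p∈P = proj₂ (Spans-bounds wA (spansC p∈P))

  s∈B : ∀ {p} → p ∈ P → s ∈ᴵ B p
  s∈B p∈P = B-intro p∈P s<n (λ _ _ q<s → q<s)

  ws≡R : R (s , suc s) ≡ w s
  ws≡R = solve 2 (λ a b → a :+ b :- a := b) ≡.refl (S s) (w s)
    where open +-*-Solver

  ws≤RB : ∀ {p} → p ∈ P → w s ≤ R (B p)
  ws≤RB p∈P = subst (_≤ R (B _)) ws≡R
    (R-mono (proj₁ (s∈B p∈P)) (ℕ.<⇒≤ s<n) (proj₂ (s∈B p∈P)) (B-bound p∈P))

  RB≤W : ∀ {p} → p ∈ P → R (B p) ≤ R (0 , n)
  RB≤W p∈P = R-⊆ (s∈B p∈P) (λ x∈ → z≤n , ℕ.<-≤-trans (proj₂ x∈) (B-bound p∈P)) ℕ.≤-refl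

  RC≤W : ∀ {p} → p ∈ P → R (C p) ≤ R (0 , n)
  RC≤W p∈P = R-⊆ (self∈C p∈P) (λ x∈ → z≤n , ℕ.<-≤-trans (proj₂ x∈) (C-bound p∈P)) ℕ.≤-refl

  0≤RC : ∀ {p} → p ∈ P → 0ℚ ≤ R (C p)
  0≤RC p∈P = 0≤R (ℕ.≤-trans (proj₁ (self∈C p∈P)) (ℕ.<⇒≤ (proj₂ (self∈C p∈P)))) (C-bound p∈P)

  side-bound : ∀ K fl →
    (∀ {i c} → i ℕ.< length nodes → fl (node# i) ≡ true → c ∈ᴵ C (node# i) → ¬ c ∈ᴵ B (node# (suc (i ℕ.+ D)))) →
    (ℕtoℚ 2 ^ℚ K) ^ℚ count fl nodes * ∏ (R ∘ C) nodes * w s ^ℚ exponent D K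
      ≤ ∏ (R ∘ B) nodes * R (0 , n) ^ℚ exponent D K
  side-bound K fl disjoint = ≡.subst₂ (λ x y → x * w s ^ℚ exponent D K ≤ y * R (0 , n) ^ℚ exponent D K)
    (≡.trans (sym (∏-nth (λ y → boost K (fl y) * R (C y)) s nodes)) (∏-boost K fl (R ∘ C) nodes))
    (≡.trans (Π-cong a (λ i → cong R (pad-+ _ D _ i))) (sym (∏-nth (R ∘ B) s nodes)))
    (telescope a D k K (R ∘ v) (R ∘ C ∘ node#) (fl ∘ node#) (pos s s<n)
      (λ i → on-v (w s ≤_) (≤-trans (ws≤RB (EndsIn-∈ (Path-EndsIn π))) (RB≤W (EndsIn-∈ (Path-EndsIn π)))) (λ j → ws≤RB (node∈P j)) i)
      (λ i → on-v (_≤ R (0 , n)) ≤-refl (λ j → RB≤W (node∈P j)) i)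
      (λ i _ → 0≤RC (node∈P i))
      (λ i i<a → R-⊆ (self∈C (node∈P i)) (C⊆v i<a) (v-bound i))
      (λ i i<a → subst (λ J → R J ≤ R (v i)) (sym (v-far i)) (R-⊆ (s∈B (node∈P _)) (B⊆v i<a) (v-bound i)))
      (λ i i<a fl-i → subst (λ J → R (C (node# i)) + R J ≤ R (v i)) (sym (v-far i))
        (R-disjoint (self∈C (node∈P i)) (s∈B (node∈P _)) (C⊆v i<a) (B⊆v i<a) (disjoint i<a fl-i) (v-bound i))))
    where
    a k : ℕ
    a = length nodes
    k = D ℕ.+ suc D

    -- `v i` is the old interval of the node `D` positions above `node# i`. The first `D` nodes have
    -- no such node and get the whole key range. Since `k` is `2D + 1`, `v (k + i)` belongs to the
    -- node `D + 1` positions below `node# i`.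
    v : ℕ → ℕ × ℕ
    v = pad (0 , n) D (B ∘ node#)

    on-v : (Q : ℚ → Set) → Q (R (0 , n)) → (∀ j → Q (R (B (node# j)))) → ∀ i → Q (R (v i))
    on-v Q Q-top Q-B i with pad-cases (0 , n) D (B ∘ node#) i
    ... | inj₁ e           = subst (Q ∘ R) (sym e) Q-top
    ... | inj₂ (j , _ , e) = subst (Q ∘ R) (sym e) (Q-B j)

    v-far : ∀ i → v (k ℕ.+ i) ≡ B (node# (suc (i ℕ.+ D)))
    v-far i = ≡.trans (cong v (ℕ.+-assoc D (suc D) i))
      (≡.trans (pad-+ _ D _ (suc D ℕ.+ i)) (cong (B ∘ node# ∘ suc) (ℕ.+-comm D i)))

    v-bound : ∀ i → proj₂ (v i) ℕ.≤ n
    v-bound i with pad-cases (0 , n) D (B ∘ node#) i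
    ... | inj₁ e           = ℕ.≤-reflexive (cong proj₂ e)
    ... | inj₂ (j , _ , e) = ℕ.≤-trans (ℕ.≤-reflexive (cong proj₂ e)) (B-bound (node∈P j))

    C⊆v : ∀ {i c} → i ℕ.< a → c ∈ᴵ C (node# i) → c ∈ᴵ v i
    C⊆v {i} {c} i<a c∈ with pad-cases (0 , n) D (B ∘ node#) i
    ... | inj₁ e = subst (c ∈ᴵ_) (sym e) (z≤n , ℕ.<-≤-trans (proj₂ c∈) (C-bound (node∈P i)))
    ... | inj₂ (j , i≡ , e) = subst (c ∈ᴵ_) (sym e) (C⊆B-shifted (subst (ℕ._< a) i≡′ i<a) (subst (λ i → c ∈ᴵ C (node# i)) i≡′ c∈))
      where i≡′ = ≡.trans i≡ (ℕ.+-comm D j)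

    B⊆v : ∀ {i c} → i ℕ.< a → c ∈ᴵ B (node# (suc (i ℕ.+ D))) → c ∈ᴵ v i
    B⊆v {i} {c} i<a c∈ with pad-cases (0 , n) D (B ∘ node#) i
    ... | inj₁ e = subst (c ∈ᴵ_) (sym e) (z≤n , ℕ.<-≤-trans (proj₂ c∈) (B-bound (node∈P (suc (i ℕ.+ D)))))
    ... | inj₂ (j , ≡.refl , e) = subst (c ∈ᴵ_) (sym e)
      (B-antitone (s≤s (ℕ.≤-trans (ℕ.m≤n+m j D) (ℕ.m≤m+n (D ℕ.+ j) D))) (ℕ.≤-<-trans (ℕ.m≤n+m j D) i<a) c∈)

-- Combining the two sides with the root

combine : ∀ {x g h h′ a b a′ b′ p p′ t} → x ≤ g * h → g * p * a ≤ p′ * a′ → h ≤ h′ → b ≤ b′ →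
          0ℚ ≤ h → 0ℚ ≤ b → 0ℚ ≤ a → 0ℚ ≤ g → 0ℚ ≤ p → 0ℚ ≤ t →
          x * (b * a * (p * t)) ≤ h′ * (b′ * a′ * (p′ * t))
combine {x} {g} {h} {h′} {a} {b} {a′} {b′} {p} {p′} {t} x≤gh main h≤h′ b≤b′ 0≤h 0≤b 0≤a 0≤g 0≤p 0≤t = begin
  x * (b * a * (p * t))
    ≤⟨ *-monoʳ-≤-nonNeg (b * a * (p * t)) {{nonNegative (0≤* (0≤* 0≤b 0≤a) (0≤* 0≤p 0≤t))}} x≤gh ⟩
  g * h * (b * a * (p * t))
    ≡⟨ solve 6 (λ g h b a p t → g :* h :* (b :* a :* (p :* t)) := (g :* p :* a) :* (h :* (b :* t))) ≡.refl g h b a p t ⟩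
  g * p * a * (h * (b * t))
    ≤⟨ *-mono-≤ (0≤* (0≤* 0≤g 0≤p) 0≤a) main (0≤* 0≤h (0≤* 0≤b 0≤t))
         (*-mono-≤ 0≤h h≤h′ (0≤* 0≤b 0≤t) (*-monoʳ-≤-nonNeg t {{nonNegative 0≤t}} b≤b′)) ⟩
  p′ * a′ * (h′ * (b′ * t))
    ≡⟨ solve 5 (λ p a h b t → p :* a :* (h :* (b :* t)) := h :* (b :* a :* (p :* t))) ≡.refl p′ a′ h′ b′ t ⟩
  h′ * (b′ * a′ * (p′ * t)) ∎
  where
  open ≤-Reasoning
  open +-*-Solver

module _ {n s D T A X P ts}
  (wT : Within 0 n T) (π : Path s T P ts X) (wX : Within 0 n X)
  (wA : Within 0 n A) (A↭P : inorder A ↭ P) (rootA : root A ≡ [ s ])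
  (gain≤D : ∀ y → y ∈ P → y ≢ s → count (gained T A y) P ℕ.≤ D)
  (w : ℕ → ℚ) (pos : PosWeights n w) (s<n : s ℕ.< n)
  (q c : ℕ)
  (loss : ∀ x → x ∈ P → q ℕ.* depth T x ℕ.+ 2 ℕ.* depth T x ℕ.≤ 2 ℕ.* q ℕ.* (lostAncestors T A x ℕ.+ c)) where

  open Weights w n pos

  private
    -- With `ℓ` losers the path has length at most `2qℓ + C₀`, so `K = 2q` makes one factor `2 ^ K`
    -- per loser pay for the path up to `2 ^ C₀`. In `c′`, each side costs `e` and the node `s`
    -- costs one more.
    K e C₀ c′ : ℕ
    K = 2 ℕ.* q
    e = exponent D K
    C₀ = 2 ℕ.* q ℕ.* c ℕ.+ 2 ℕ.* q ℕ.+ 3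
    c′ = C₀ ℕ.+ (suc e ℕ.+ e)

    θ W : ℚ
    θ = w s
    W = R (0 , n)

    nodes : Bool → List ℕ
    nodes σ = filterᵇ (side σ s) P

    B C : ℕ → ℚ
    B y = R (span X 0 n y)
    C y = R (span A 0 n y)

    length-nodes : ∀ σ → length P ≡ suc (length (nodes σ) ℕ.+ length (nodes (not σ)))
    length-nodes true  = length-sides wT π
    length-nodes false = ≡.trans (length-sides wT π) (cong suc (ℕ.+-comm (length (nodes true)) _))

    s∈P : s ∈ P
    s∈P = EndsIn-∈ (Path-EndsIn π)

    open SideBound wT π wX wA A↭P rootA gain≤D w pos s<n using (side-bound; ws≤RB; RB≤W; RC≤W; 0≤RC)

    0<θ : 0ℚ < θ
    0<θ = pos s s<n

    θ≤W : θ ≤ W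
    θ≤W = ≤-trans (ws≤RB true s∈P) (RB≤W true s∈P)

    0≤∏C : ∀ σ → 0ℚ ≤ ∏ C (nodes σ)
    0≤∏C σ = 0≤∏ C (nodes σ) (λ x∈ → 0≤RC true (proj₁ (filterᵇ-⊆ P x∈)))

    0≤∏CP : 0ℚ ≤ ∏ C P
    0≤∏CP = 0≤∏ C P (0≤RC true)

    0≤2^ : ∀ n → 0ℚ ≤ ℕtoℚ 2 ^ℚ n
    0≤2^ n = <⇒≤ (0<^ n (positive⁻¹ (ℕtoℚ 2)))

    0≤θ^ : ∀ n → 0ℚ ≤ θ ^ℚ n
    0≤θ^ n = <⇒≤ (0<^ n 0<θ)

    Losing : ℕ → Set
    Losing λ# = length P ℕ.≤ K ℕ.* λ# ℕ.+ C₀ ×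
      (ℕtoℚ 2 ^ℚ K) ^ℚ λ# * ∏ C P * θ ^ℚ (suc e ℕ.+ e) ≤ ∏ B P * W ^ℚ (suc e ℕ.+ e)

    -- Only the majority side `σ` supplies losers. The other side enters with nobody declared a
    -- loser, and `s` contributes through `C s ≤ W` and `θ ≤ B s`.
    both-sides : ∀ σ → length (nodes (not σ)) ℕ.≤ length (nodes σ) → ∃ Losing
    both-sides σ minority
      with fl , disjoint , P≤ ← Losers.losers wT π wX wA A↭P rootA gain≤D q c loss σ
             (ℕ.≤-trans (ℕ.≤-reflexive (length-nodes σ)) (s≤s (ℕ.+-monoʳ-≤ (length (nodes σ)) (ℕ.≤-trans minority (ℕ.m≤m+n _ 0)))))
      = count fl (nodes σ) , P≤ , (begin
      G * ∏ C P * θ ^ℚ (suc e ℕ.+ e)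
        ≡⟨ cong₂ (λ u v → G * u * v) (∏-sides C wT π σ) (^-+ θ (suc e) e) ⟩
      G * (∏ C M * ∏ C N * C s) * (θ * θ ^ℚ e * θ ^ℚ e)
        ≡⟨ solve 6 (λ g m n c t u → g :* (m :* n :* c) :* (t :* u :* u) := (g :* m :* u) :* (n :* u) :* (c :* t))
             ≡.refl G (∏ C M) (∏ C N) (C s) θ (θ ^ℚ e) ⟩
      (G * ∏ C M * θ ^ℚ e) * (∏ C N * θ ^ℚ e) * (C s * θ)
        ≤⟨ *-mono-≤ (0≤* (0≤* (0≤* 0≤G (0≤∏C σ)) (0≤θ^ e)) (0≤* (0≤∏C (not σ)) (0≤θ^ e)))
             (*-mono-≤ (0≤* (0≤* 0≤G (0≤∏C σ)) (0≤θ^ e)) (side-bound σ K fl disjoint)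
                       (0≤* (0≤∏C (not σ)) (0≤θ^ e)) other-side)
             (0≤* (0≤RC true s∈P) (<⇒≤ 0<θ))
             (*-mono-≤ (0≤RC true s∈P) (RC≤W true s∈P) (<⇒≤ 0<θ) (ws≤RB true s∈P)) ⟩
      (∏ B M * W ^ℚ e) * (∏ B N * W ^ℚ e) * (W * B s)
        ≡⟨ solve 5 (λ m n b t u → (m :* u) :* (n :* u) :* (t :* b) := (m :* n :* b) :* (t :* u :* u))
             ≡.refl (∏ B M) (∏ B N) (B s) W (W ^ℚ e) ⟩
      (∏ B M * ∏ B N * B s) * (W * W ^ℚ e * W ^ℚ e)
        ≡⟨ cong₂ _*_ (∏-sides B wT π σ) (^-+ W (suc e) e) ⟨
      ∏ B P * W ^ℚ (suc e ℕ.+ e) ∎)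
      where
      open ≤-Reasoning
      open +-*-Solver
      M N : List ℕ
      M = nodes σ
      N = nodes (not σ)
      G : ℚ
      G = (ℕtoℚ 2 ^ℚ K) ^ℚ count fl M
      0≤G : 0ℚ ≤ G
      0≤G = <⇒≤ (0<^ (count fl M) (0<^ K (positive⁻¹ (ℕtoℚ 2))))
      other-side : ∏ C N * θ ^ℚ e ≤ ∏ B N * W ^ℚ e
      other-side = subst (λ x → x * θ ^ℚ e ≤ ∏ B N * W ^ℚ e)
        (≡.trans (cong (λ u → (ℕtoℚ 2 ^ℚ K) ^ℚ u * ∏ C N) (count-never N)) (*-identityˡ (∏ C N)))
        (side-bound (not σ) K (λ _ → false) (λ _ ()))

  -- `t` stands for the product over the pendent subtrees, a factor common to both potentials.
  path-bound : (t : ℚ) → 0ℚ ≤ t →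
    ℕtoℚ 2 ^ℚ length P * (θ ^ℚ c′ * (∏ C P * t)) ≤ ℕtoℚ 2 ^ℚ c′ * (W ^ℚ c′ * (∏ B P * t))
  path-bound t 0≤t = case-majority (ℕ.≤-total (length (nodes false)) (length (nodes true)))
    where
    e′ : ℕ
    e′ = suc e ℕ.+ e

    conclude : ∃ Losing →
      ℕtoℚ 2 ^ℚ length P * (θ ^ℚ c′ * (∏ C P * t)) ≤ ℕtoℚ 2 ^ℚ c′ * (W ^ℚ c′ * (∏ B P * t))
    conclude (λ# , P≤ , main) =
      ≡.subst₂ (λ x y → ℕtoℚ 2 ^ℚ length P * (x * (∏ C P * t)) ≤ ℕtoℚ 2 ^ℚ c′ * (y * (∏ B P * t)))
        (sym (^-+ θ C₀ e′)) (sym (^-+ W C₀ e′))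
        (combine {ℕtoℚ 2 ^ℚ length P} {(ℕtoℚ 2 ^ℚ K) ^ℚ λ#} {ℕtoℚ 2 ^ℚ C₀} {ℕtoℚ 2 ^ℚ c′}
                 {θ ^ℚ e′} {θ ^ℚ C₀} {W ^ℚ e′} {W ^ℚ C₀} {∏ C P} {∏ B P} {t}
          (≤-trans (^-monoʳ 1≤2 P≤) (≤-reflexive (2^≡ λ#))) main
          (^-monoʳ 1≤2 (ℕ.m≤m+n C₀ e′)) (^-monoˡ C₀ 0<θ θ≤W)
          (0≤2^ C₀) (0≤θ^ C₀) (0≤θ^ e′)
          (<⇒≤ (0<^ λ# (0<^ K (positive⁻¹ (ℕtoℚ 2))))) 0≤∏CP 0≤t)
      where
      1≤2 : 1ℚ ≤ ℕtoℚ 2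
      1≤2 = subst (_≤ ℕtoℚ 2) (+-identityʳ 1ℚ) (+-monoʳ-≤ 1ℚ {0ℚ} {1ℚ} (nonNegative⁻¹ 1ℚ))
      2^≡ : ∀ λ# → ℕtoℚ 2 ^ℚ (K ℕ.* λ# ℕ.+ C₀) ≡ (ℕtoℚ 2 ^ℚ K) ^ℚ λ# * ℕtoℚ 2 ^ℚ C₀
      2^≡ λ# = ≡.trans (^-+ (ℕtoℚ 2) (K ℕ.* λ#) C₀) (cong (_* ℕtoℚ 2 ^ℚ C₀)
        (≡.trans (cong (ℕtoℚ 2 ^ℚ_) (ℕ.*-comm K λ#)) (^-* (ℕtoℚ 2) K λ#)))

    case-majority : length (nodes false) ℕ.≤ length (nodes true) ⊎ length (nodes true) ℕ.≤ length (nodes false) →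
      ℕtoℚ 2 ^ℚ length P * (θ ^ℚ c′ * (∏ C P * t)) ≤ ℕtoℚ 2 ^ℚ c′ * (W ^ℚ c′ * (∏ B P * t))
    case-majority (inj₁ le) = conclude (both-sides true le)
    case-majority (inj₂ le) = conclude (both-sides false le)

-- From trees to intervals: the access lemma

theorem10 : (𝒜 : MinSelfAdjAlg) (ε : ℚ) (c D : ℕ) → 0ℚ < ε →
    (∀ n T s A → Access 𝒜 n T s A → ∀ x → x ∈ searchPath T s →
    ((½ + ε) * ℕtoℚ (depth T x)) - ℕtoℚ c ≤ ℕtoℚ (lostAncestors T A x)) →
    (∀ n T s A → Access 𝒜 n T s A → ∀ y → y ∈ searchPath T s → y ≢ s →
    gainedDescendants T s A y Data.Nat.≤ D) →
    AccessLemma 𝒜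
theorem10 𝒜 ε c D 0<ε loses gains = c′ , access-bound
  where
  -- The constants depend on `ε`, `c` and `D` only, hence are fixed before any tree, weight or
  -- access is given.
  q = ↧ₙ ε
  C₀ = 2 ℕ.* q ℕ.* c ℕ.+ 2 ℕ.* q ℕ.+ 3
  e = exponent D (2 ℕ.* q)
  c′ = C₀ ℕ.+ (suc e ℕ.+ e)

  access-bound : ∀ n T s A w → PosWeights n w → Access 𝒜 n T s A →
    ℕtoℚ 2 ^ℚ length (searchPath T s) * (w s ^ℚ c′ * expPotential w (restructure T s A))
      ≤ ℕtoℚ 2 ^ℚ c′ * (weightOf w (upTo n) ^ℚ c′ * expPotential w T)
  access-bound n T s A w pos access@(bst , s<n , chosen) =
    bound (afterTree 𝒜 bst s<n chosen) (path T wT (subst (s ∈_) (sym bst) (∈-upTo⁺ s<n)))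
    where
    open Weights w n pos
    open ≡.≡-Reasoning
    P = searchPath T s
    ts = pendants T s

    run : Run 0 n (inorder T)
    run = subst (Run 0 n) (sym bst) (Run-upTo n)

    wT : Within 0 n T
    wT = Run⇒Within T run

    bound : IsAfterTree T s A → (∃ λ X → Path s T P ts X) →
      ℕtoℚ 2 ^ℚ length P * (w s ^ℚ c′ * expPotential w (restructure T s A))
        ≤ ℕtoℚ 2 ^ℚ c′ * (weightOf w (upTo n) ^ℚ c′ * expPotential w T)
    bound (A↭P , A-sorted , rootA) (X , π) =
      ≡.subst₂ (λ x y → ℕtoℚ 2 ^ℚ length P * (w s ^ℚ c′ * x) ≤ ℕtoℚ 2 ^ℚ c′ * y)
        (sym exp-T′) (cong₂ (λ x y → x ^ℚ c′ * y) (sym (weightOf-Run (Run-upTo n))) (sym exp-T))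
        (path-bound wT π wX wA A↭P rootA (gains n T s A access) w pos s<n q c
          (λ x x∈P → clear-denominators ε c (depth T x) (lostAncestors T A x) 0<ε (loses n T s A access x x∈P))
          (∏ (expPotential w) ts) (0≤∏ (expPotential w) ts (0≤pendants run ℕ.≤-refl π)))
      where
      fill-X : fill X ts ≡ (T , [])
      fill-X = ≡.trans (cong (fill X) (sym (++-identityʳ ts))) (Path-fill π [])

      run-X : Run 0 n (inorder (proj₁ (fill X ts)))
      run-X = subst (λ f → Run 0 n (inorder (proj₁ f))) (sym fill-X) run

      wX : Within 0 n X
      wX = Run-fill⇒Within X ts run-X

      -- Both trees carry the path nodes in sorted order. Hence filling either gives the same
      -- inorder list and leaves no tree over, and both potentials factor over the same path nodes
      -- and pendent subtrees.
      A≡X : inorder A ≡ inorder X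
      A≡X = sorted-↭⇒≡ A-sorted (AllPairs⇒Linked (Within-sorted wX)) (↭-trans A↭P (↭-sym (Path-inorder π)))

      run-A : Run 0 n (inorder (proj₁ (fill A ts)))
      run-A = subst (Run 0 n) (≡.trans (inorder-fill X ts)
        (≡.trans (cong (λ ks → flat ks ts) (sym A≡X)) (sym (inorder-fill A ts)))) run-X

      wA : Within 0 n A
      wA = Run-fill⇒Within A ts run-A

      rest-A : proj₂ (fill A ts) ≡ []
      rest-A = begin
        proj₂ (fill A ts)                    ≡⟨ fill-rest A ts ⟩
        drop (suc (length (inorder A))) ts   ≡⟨ cong (λ ks → drop (suc (length ks)) ts) A≡X ⟩
        drop (suc (length (inorder X))) ts   ≡⟨ fill-rest X ts ⟨
        proj₂ (fill X ts)                    ≡⟨ cong proj₂ fill-X ⟩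
        []                                   ∎

      exp-fill : ∀ Y → Run 0 n (inorder (proj₁ (fill Y ts))) → proj₂ (fill Y ts) ≡ [] → inorder Y ↭ P →
        expPotential w (proj₁ (fill Y ts)) ≡ ∏ (R ∘ span Y 0 n) P * ∏ (expPotential w) ts
      exp-fill Y ρ rest Y↭P = begin
        expPotential w (proj₁ (fill Y ts))   ≡⟨ *-identityʳ _ ⟨
        expPotential w (proj₁ (fill Y ts)) * 1ℚ
          ≡⟨ cong (λ us → expPotential w (proj₁ (fill Y ts)) * ∏ (expPotential w) us) rest ⟨
        expPotential w (proj₁ (fill Y ts)) * ∏ (expPotential w) (proj₂ (fill Y ts))
          ≡⟨ expPotential-fill Y ts ρ ⟩
        ∏ (R ∘ span Y 0 n) (inorder Y) * ∏ (expPotential w) ts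
          ≡⟨ cong (_* ∏ (expPotential w) ts) (∏-↭ (R ∘ span Y 0 n) Y↭P) ⟩
        ∏ (R ∘ span Y 0 n) P * ∏ (expPotential w) ts ∎

      exp-T′ : expPotential w (restructure T s A) ≡ ∏ (R ∘ span A 0 n) P * ∏ (expPotential w) ts
      exp-T′ = exp-fill A run-A rest-A A↭P

      exp-T : expPotential w T ≡ ∏ (R ∘ span X 0 n) P * ∏ (expPotential w) ts
      exp-T = ≡.trans (cong (expPotential w ∘ proj₁) (sym fill-X))
        (exp-fill X run-X (cong proj₂ fill-X) (Path-inorder π))
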